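{- Let $\Sigma$ be a signed graph. Write its chromatic $B$-symmetric function $X_\Sigma$ as a polynomial with rational coefficients in the elements of the augmented elementary $B$-symmetric basis $\{e_n : n\ge 1\}\cup\{q_{a,b}: a,b\ge 1\}\cup\{z\}$. Then for every $k\ge 0$, the number of acyclic orientations of $\Sigma$ with exactly $k$ sinks equals the sum of the coefficients of those monomials that contain exactly $k$ factors of the form $e_n$ (counted with multiplicity).
   Context: A signed graph $\Sigma$ is a finite graph (loops and multiple edges allowed) together with a sign function $\mathrm{sgn}:E(\Sigma)\to\{+,-\}$; write $e:uv$ if $e$ has endpoints $u,v$ ($u=v$ for a loop). A coloring is a map $\kappa:V(\Sigma)\to\mathbb{Z}$; it is proper if $\kappa(u)\neq \mathrm{sgn}(e)\kappa(v)$ for every edge $e:uv$. The chromatic $B$-symmetric function is $X_\Sigma=\sum_{\kappa\text{ proper}}\prod_{v\in V(\Sigma)}x_{\kappa(v)}$, a formal power series in commuting variables $x_i$, $i\in\mathbb{Z}$. An orientation of $\Sigma$ assigns to each incidence of an edge with an endpoint (each half-edge; a loop has two) an arrow pointing toward or away from that vertex, such that on a positive edge exactly one of the two arrows points toward its vertex, and on a negative edge the two arrows either both point toward their vertices or both point away. A cycle is a closed walk such that, considering only the edges of the walk, every vertex of the walk has at least one arrow pointing into it and at least one pointing out of it; an orientation is acyclic if it has no cycle. A sink is a vertex all of whose incident arrows point toward it (an isolated vertex is a sink). Notation: $p_{a,b}=\sum_{i\in\mathbb{Z}}x_i^a x_{ -i}^b$; $q_{a,b}=(-1)^{a+b+1}p_{a,b}$;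 $z=-x_0$; $e_n=\sum_{i_1<i_2<\dots<i_n,\ i_j\in\mathbb{Z}}x_{i_1}\cdots x_{i_n}$. The paper states that every chromatic $B$-symmetric function can be written uniquely as a polynomial in $\{e_n : n\ge1\}\cup\{q_{a,b}:a,b\ge1\}\cup\{z\}$. -}

module Defs where

open import Data.Fin.Base as Fin using (Fin; zero; suc; toℕ; opposite)
import Data.Fin.Properties as Fin
open import Data.Integer.Base as ℤ using (ℤ; +_; _◃_)
import Data.Integer.Properties as ℤ
open import Data.List.Base as List using
  (List; []; _∷_; filter; length; foldr; upTo; allFin; cartesianProductWith; replicate)
open import Data.List.Membership.Propositional using (_∈_)
open import Data.List.Relation.Unary.Linked using (Linked; linked?)
open import Data.List.Relation.Unary.Unique.Propositional using (Unique)
open import Data.Nat.Base as ℕ using (ℕ; zero; suc)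
import Data.Nat.Properties as ℕ
open import Data.Product using (Σ-syntax; ∃-syntax; _×_; _,_; proj₁; proj₂)
open import Data.Rational.Base as ℚ using (ℚ; 0ℚ; 1ℚ)
open import Data.Sign.Base using (Sign)
open import Data.Sum.Base using (_⊎_)
open import Data.Vec.Base as Vec using (Vec; []; _∷_; lookup; tabulate; toList)
import Data.Vec.Properties as Vec
open import Function.Bundles using (_⇔_)
open import Relation.Binary.Definitions using (DecidableEquality)
open import Relation.Binary.PropositionalEquality using (_≡_; _≢_; refl)
open import Relation.Nullary using (¬_; Dec; yes; no)
open import Relation.Nullary.Decidable using (¬?; _→-dec_)

-- Loops and multiple edges are allowed. Edges are undirected: the order of
-- the two ends `endpoint e zero`, `endpoint e (suc zero)` only serves to name
-- the two half-edges of e. A loop has equal endpoints and still two half-edges.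
record SignedGraph : Set where
  field
    order    : ℕ
    size     : ℕ
    endpoint : Fin size → Fin 2 → Fin order
    sgn      : Fin size → Sign

  Vertex Edge : Set
  Vertex = Fin order
  Edge   = Fin size

Coloring : SignedGraph → Set
Coloring G = Vec ℤ (SignedGraph.order G)

Proper : (G : SignedGraph) → Coloring G → Set
Proper G κ = ∀ e →
  lookup κ (endpoint e zero) ≢ (sgn e ◃ 1) ℤ.* lookup κ (endpoint e (suc zero))
  where open SignedGraph G

proper? : (G : SignedGraph) (κ : Coloring G) → Dec (Proper G κ)
proper? G κ = Fin.all? λ e → ¬? (_ ℤ.≟ _)

colors : (N : ℕ) → Vec ℤ (suc (N ℕ.+ N))
colors N = tabulate λ j → + toℕ j ℤ.- + N

-- A monomial in the x_i involves only finitely many variables, so it is given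
-- by a bound N together with the exponents of x_{-N} , … , x_N.
Exponents : ℕ → Set
Exponents N = Vec ℕ (suc (N ℕ.+ N))

-- A formal power series over ℚ in commuting variables x_i, i ∈ ℤ, is given by
-- its coefficients. The same monomial is presented at
-- every sufficiently large N; all series built below give it the same
-- coefficient at each such N.
Series : Set
Series = ∀ N → Exponents N → ℚ

infix 4 _≈_
_≈_ : Series → Series → Set
f ≈ g = ∀ N α → f N α ≡ g N α

sumℚ : List ℚ → ℚ
sumℚ = foldr ℚ._+_ 0ℚ

fromℕ : ℕ → ℚ
fromℕ n = + n ℚ./ 1

splitℕ : ℕ → List (ℕ × ℕ)
splitℕ a = List.map (λ b → b , a ℕ.∸ b) (upTo (suc a))

splits : ∀ {n} → Vec ℕ n → List (Vec ℕ n × Vec ℕ n)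
splits []      = ([] , []) ∷ []
splits (a ∷ α) = cartesianProductWith
  (λ { (b , c) (β , γ) → (b ∷ β) , (c ∷ γ) }) (splitℕ a) (splits α)

infixl 6 _+ₛ_
infixl 7 _*ₛ_ _·_

_+ₛ_ : Series → Series → Series
(f +ₛ g) N α = f N α ℚ.+ g N α

_·_ : ℚ → Series → Series
(c · f) N α = c ℚ.* f N α

_*ₛ_ : Series → Series → Series
(f *ₛ g) N α = sumℚ (List.map (λ { (β , γ) → f N β ℚ.* g N γ }) (splits α))

-- The exponents of x_{i₁} ⋯ x_{iₗ}, for a word i₁ … iₗ in -N , … , N.
exponents : ∀ N → List ℤ → Exponents N
exponents N w = Vec.map (λ i → length (filter (i ℤ.≟_) w)) (colors N)

-- The sum of x_{i₁} ⋯ x_{iₗ} over a possibly infinite family of words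
-- i₁ … iₗ. Here `words N` must list the members of the family all of whose
-- letters lie in -N , … , N (there are finitely many of these for each family
-- used below); these are the only ones contributing to the coefficient of a
-- monomial in x_{-N} , … , x_N.
wordSum : (ℕ → List (List ℤ)) → Series
wordSum words N α =
  fromℕ (length (filter (λ w → Vec.≡-dec ℕ._≟_ (exponents N w) α) (words N)))

tuples : {A : Set} → (n : ℕ) → List A → List (Vec A n)
tuples zero    as = [] ∷ []
tuples (suc n) as = cartesianProductWith _∷_ as (tuples n as)

colorTuples : (n N : ℕ) → List (Vec ℤ n)
colorTuples n N = tuples n (toList (colors N))

0ₛ 1ₛ : Series
0ₛ N α = 0ℚ
1ₛ     = wordSum λ N → [] ∷ []

X : SignedGraph → Series
X G = wordSum λ N →
  List.map toList (filter (proper? G) (colorTuples (SignedGraph.order G) N))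

e : ℕ → Series
e n = wordSum λ N →
  filter (linked? ℤ._<?_) (List.map toList (colorTuples n N))

-- Only used for a , b ≥ 1, so that x_i^a x_{-i}^b involves both x_i and x_{-i}.
p : ℕ → ℕ → Series
p a b = wordSum λ N →
  List.map (λ i → replicate a i List.++ replicate b (ℤ.- i)) (toList (colors N))

q : ℕ → ℕ → Series
q a b = ((ℤ.-1ℤ ℤ.^ (a ℕ.+ b ℕ.+ 1)) ℚ./ 1) · p a b

x₀ z : Series
x₀ = wordSum λ N → (+ 0 ∷ []) ∷ []
z  = (ℚ.- 1ℚ) · x₀

-- e[1+ n ] stands for e_{n+1} and q[1+ a ,1+ b ] for q_{a+1,b+1}. Since
-- q_{a,b} = q_{b,a} as series, the two symbols are interchangeable under
-- evaluation.
data Generator : Set where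
  e[1+_]     : ℕ → Generator
  q[1+_,1+_] : ℕ → ℕ → Generator
  𝕫          : Generator

-- A finite formal sum of terms c · g₁ ⋯ gₗ. Like terms need not be collected.
Polynomial : Set
Polynomial = List (ℚ × List Generator)

⟦_⟧ᵍ : Generator → Series
⟦ e[1+ n ] ⟧ᵍ         = e (suc n)
⟦ q[1+ a ,1+ b ] ⟧ᵍ   = q (suc a) (suc b)
⟦ 𝕫 ⟧ᵍ                = z

⟦_⟧ᵐ : List Generator → Series
⟦ gs ⟧ᵐ = foldr (λ g f → ⟦ g ⟧ᵍ *ₛ f) 1ₛ gs

⟦_⟧ : Polynomial → Series
⟦ P ⟧ = foldr (λ { (c , gs) f → c · ⟦ gs ⟧ᵐ +ₛ f }) 0ₛ P

eDegree : List Generator → ℕ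
eDegree []                     = 0
eDegree (e[1+ _ ] ∷ gs)        = suc (eDegree gs)
eDegree (q[1+ _ ,1+ _ ] ∷ gs)  = eDegree gs
eDegree (𝕫 ∷ gs)               = eDegree gs

-- The sum of the coefficients of the monomials with exactly k factors e_n;
-- it does not depend on whether like terms are collected.
coefficientSum : ℕ → Polynomial → ℚ
coefficientSum k P =
  sumℚ (List.map proj₁ (filter (λ t → eDegree (proj₂ t) ℕ.≟ k) P))

-- Whether an arrow on a half-edge points toward or away from its vertex.
data Arrow : Set where
  toward away : Arrow

_≟ᵃ_ : DecidableEquality Arrow
toward ≟ᵃ toward = yes refl
toward ≟ᵃ away   = no λ ()
away   ≟ᵃ toward = no λ ()
away   ≟ᵃ away   = yes refl

Compatible : Sign → Arrow → Arrow → Set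
Compatible Sign.+ s t = s ≢ t
Compatible Sign.- s t = s ≡ t

module _ (G : SignedGraph) where
  open SignedGraph G

  Arrows : Set
  Arrows = Vec (Vec Arrow 2) size

  arrow : Arrows → Edge → Fin 2 → Arrow
  arrow o ε h = lookup (lookup o ε) h

  IsOrientation : Arrows → Set
  IsOrientation o = ∀ ε → Compatible (sgn ε) (arrow o ε zero) (arrow o ε (suc zero))

  data Walk : Vertex → Vertex → Set where
    []   : ∀ {v} → Walk v v
    step : ∀ {u v w} (ε : Edge) (h : Fin 2) →
           endpoint ε h ≡ u → endpoint ε (opposite h) ≡ v → Walk v w → Walk u w

  vertices : ∀ {u v} → Walk u v → List Vertex
  vertices {u} []               = u ∷ []
  vertices {u} (step _ _ _ _ w) = u ∷ vertices w

  edges : ∀ {u v} → Walk u v → List Edge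
  edges []               = []
  edges (step ε _ _ _ w) = ε ∷ edges w

  HasArrow : Arrows → List Edge → Vertex → Arrow → Set
  HasArrow o εs v d =
    ∃[ ε ] ∃[ h ] ε ∈ εs × endpoint ε h ≡ v × arrow o ε h ≡ d

  -- Only the arrows on edges of the walk count, and they count at every vertex
  -- of the walk, including its endpoint. The walk of length 0 is never a cycle,
  -- as no arrow is available at its vertex.
  IsCycle : Arrows → ∀ {v} → Walk v v → Set
  IsCycle o w = ∀ u → u ∈ vertices w →
    HasArrow o (edges w) u toward × HasArrow o (edges w) u away

  Acyclic : Arrows → Set
  Acyclic o = ∀ v (w : Walk v v) → ¬ IsCycle o w

  Sink : Arrows → Vertex → Set
  Sink o v = ∀ ε h → endpoint ε h ≡ v → arrow o ε h ≡ toward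

  sink? : ∀ o v → Dec (Sink o v)
  sink? o v = Fin.all? λ ε → Fin.all? λ h →
    (endpoint ε h Fin.≟ v) →-dec (arrow o ε h ≟ᵃ toward)

  sinks : Arrows → ℕ
  sinks o = length (filter (sink? o) (allFin order))

  AcyclicOrientationWithSinks : ℕ → Arrows → Set
  AcyclicOrientationWithSinks k o = IsOrientation o × Acyclic o × sinks o ≡ k

HasCount : {A : Set} → (A → Set) → ℕ → Set
HasCount {A} P c =
  Σ[ xs ∈ List A ] Unique xs × (∀ x → x ∈ xs ⇔ P x) × length xs ≡ c

{-# OPTIONS --safe #-}
-- Put x_{m+1} = t − 1, x_{−m−1} = 0, x_i = −1 for |i| ≤ m and all other variables 0.
-- Then e_n, q_{a,b} and z take values that are polynomial in j = m + 1 and that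
-- extrapolate to t, 1 and 1 at j = 0, so a monomial becomes t^(number of factors e_n).
-- On the other side X_Σ is the sum over all orientations of the colorings that are
-- strictly compatible with the orientation. The vertices of the largest and of the
-- smallest color of such a coloring are sinks and sources; peeling them off shows that
-- the signed number of compatible colorings in −m , … , m is polynomial in j, and that
-- its extrapolation to j = 0 is 1 if the orientation is acyclic and 0 if not: an acyclic
-- orientation with an edge has a sink or source that is not isolated, which makes the
-- alternating sum over the sets of peeled sinks and sources vanish. An acyclic
-- orientation thus contributes the sum of (t − 1)^|S| over all sets S of sinks, that is
-- t^(number of sinks), and the theorem follows by comparing coefficients of powers of t.

module Submission where

open import Defs

open import Algebra.Bundles using (CommutativeRing)
import Algebra.Properties.AbelianGroup as AbelianGroup
import Algebra.Properties.CommutativeMonoid.Sum as CommutativeMonoidSum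
import Algebra.Properties.Semiring.Exp as Exponentiation
open import Data.Bool.Base using (true; false; if_then_else_)
open import Data.Empty using (⊥-elim)
open import Data.Fin.Base as Fin using (Fin; zero; suc)
import Data.Fin.Properties as Fin
open import Data.Fin.Subset as Subset
  using (Subset; _⊆_; _∩_; _∪_; ⊤; ⁅_⁆; Nonempty; ∣_∣) renaming (_∈_ to _∈ˢ_)
import Data.Fin.Subset.Properties as Subset
open import Data.Integer.Base as ℤ using (ℤ)
import Data.Integer.Properties as ℤ
open import Data.List.Base as List using
  (List; []; _∷_; _++_; filter; length; cartesianProductWith)
import Data.List.Membership.DecPropositional as DecMembership
open import Data.List.Membership.Propositional using (_∈_; find)
import Data.List.Membership.Propositional.Properties as ∈
import Data.List.Properties as List
open import Data.List.Relation.Unary.All as All using (All; []; _∷_)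
import Data.List.Relation.Unary.All.Properties as All
open import Data.List.Relation.Unary.AllPairs as AllPairs using (AllPairs; []; _∷_)
import Data.List.Relation.Unary.AllPairs.Properties as AllPairs
open import Data.List.Relation.Unary.Any using (Any; here; there)
open import Data.List.Relation.Unary.Linked using (linked?; _∷_)
import Data.List.Relation.Unary.Unique.DecPropositional.Properties as DecUnique
open import Data.List.Relation.Unary.Unique.Propositional using (Unique)
import Data.List.Relation.Unary.Unique.Propositional.Properties as Unique
open import Data.Maybe.Base using (Maybe; just; nothing; is-nothing)
import Data.Maybe.Properties as Maybe
open import Data.Nat.Base as ℕ using (ℕ; zero; suc)
import Data.Nat.Properties as ℕ
open import Data.Product using (Σ-syntax; ∃-syntax; _×_; _,_; proj₁; proj₂)
open import Data.Rational.Base as ℚ using (ℚ; 0ℚ; 1ℚ; _+_; _*_; _-_; -_)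
import Data.Rational.Properties as ℚ
open import Data.Rational.Solver using (module +-*-Solver)
import Data.Rational.Unnormalised.Base as ℚᵘ
import Data.Rational.Unnormalised.Properties as ℚᵘ
open import Data.Sign.Base using (Sign)
open import Data.Sum.Base using (_⊎_; inj₁; inj₂; [_,_]′; map₁)
open import Data.Unit.Base using (tt) renaming (⊤ to Unit)
open import Data.Vec.Base as Vec using (Vec; []; _∷_; lookup)
import Data.Vec.Membership.Propositional.Properties as Vec∈
import Data.Vec.Properties as Vec
import Data.Vec.Relation.Unary.Any as VecAny
import Data.Vec.Relation.Unary.Any.Properties as VecAny
open import Function.Base using (_∘_; id)
open import Function.Bundles using (_⇔_; mk⇔)
open import Relation.Binary.Definitions using (DecidableEquality; tri<; tri≈; tri>)
open import Relation.Binary.PropositionalEquality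
open import Relation.Nullary using (¬_; Dec; yes; no; does; contradiction)
open import Relation.Nullary.Decidable using (_×-dec_; _⊎-dec_; _→-dec_; ¬?; map′)
open import Relation.Unary using (Decidable)

open Exponentiation (CommutativeRing.semiring ℚ.+-*-commutativeRing) using (_^_; ^-homo-*)
open CommutativeMonoidSum ℚ.*-1-commutativeMonoid using () renaming
  (sum to ∏; sum-cong-≗ to ∏-cong; ∑-distrib-+ to ∏-distrib-*)
open +-*-Solver using (solve; _:=_; _:+_; _:*_; _:-_; con)
open ≡-Reasoning

-- No finite substitution does the job directly: every `e_n` should become `t`, yet with finitely
-- many nonzero variables `e_n` vanishes for large `n`. At `j = 0` there are formally `2 j - 1 = -1`
-- variables of value -1, and the generating function of the `e_n` turns into
-- `(1 + (t - 1) u) / (1 - u)`, whose higher coefficients are all `t`. The value 0 at the color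
-- `-m-1` makes the terms of `m + 1` and `-m-1` in every `q` vanish, which keeps `t` out of them.
-- The extrapolation on the side of the colorings is guessed and then confirmed: a function of `j`
-- is defined to be the indicator of acyclicity at `j = 0` and to follow the peeling recursion from
-- there, and it is compared with the true sum for the single color 0. A nontrivial peeling leaves a
-- smaller vertex set, so the recursion itself shows that the function is polynomial. Peeling leads
-- to induced subgraphs, for which closed walks are awkward. Acyclicity is therefore expressed by
-- vertex sets: no nonempty set has arrows of both directions at each of its vertices, counting only
-- edges inside the set.

private variable
  A B C : Set
  P Q   : Set

-- Finite sums, indicators and products

∑ : List A → (A → ℚ) → ℚ
∑ xs f = sumℚ (List.map f xs)

∑-cong-∈ : ∀ (xs : List A) {f g : A → ℚ} → (∀ x → x ∈ xs → f x ≡ g x) → ∑ xs f ≡ ∑ xs g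
∑-cong-∈ []       f≡g = refl
∑-cong-∈ (x ∷ xs) f≡g = cong₂ _+_ (f≡g x (here refl)) (∑-cong-∈ xs λ y y∈ → f≡g y (there y∈))

∑-cong : ∀ (xs : List A) {f g : A → ℚ} → f ≗ g → ∑ xs f ≡ ∑ xs g
∑-cong xs f≡g = ∑-cong-∈ xs λ x _ → f≡g x

∑-zero : ∀ (xs : List A) → ∑ xs (λ _ → 0ℚ) ≡ 0ℚ
∑-zero []       = refl
∑-zero (x ∷ xs) = trans (ℚ.+-identityˡ _) (∑-zero xs)

∑-+ : ∀ (xs : List A) (f g : A → ℚ) → ∑ xs (λ x → f x + g x) ≡ ∑ xs f + ∑ xs g
∑-+ []       f g = refl
∑-+ (x ∷ xs) f g = trans (cong ((f x + g x) +_) (∑-+ xs f g))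
  (solve 4 (λ a b c d → (a :+ b) :+ (c :+ d) := (a :+ c) :+ (b :+ d)) refl
    (f x) (g x) (∑ xs f) (∑ xs g))

∑-*ˡ : ∀ (xs : List A) (c : ℚ) (f : A → ℚ) → ∑ xs (λ x → c * f x) ≡ c * ∑ xs f
∑-*ˡ []       c f = sym (ℚ.*-zeroʳ c)
∑-*ˡ (x ∷ xs) c f = trans (cong (c * f x +_) (∑-*ˡ xs c f)) (sym (ℚ.*-distribˡ-+ c _ _))

∑-*ʳ : ∀ (xs : List A) (c : ℚ) (f : A → ℚ) → ∑ xs (λ x → f x * c) ≡ ∑ xs f * c
∑-*ʳ xs c f = trans (∑-cong xs λ x → ℚ.*-comm (f x) c) (trans (∑-*ˡ xs c f) (ℚ.*-comm c _))

∑-++ : ∀ (xs ys : List A) (f : A → ℚ) → ∑ (xs ++ ys) f ≡ ∑ xs f + ∑ ys f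
∑-++ []       ys f = sym (ℚ.+-identityˡ _)
∑-++ (x ∷ xs) ys f = trans (cong (f x +_) (∑-++ xs ys f)) (sym (ℚ.+-assoc (f x) _ _))

∑-map : ∀ (h : A → B) (xs : List A) (f : B → ℚ) → ∑ (List.map h xs) f ≡ ∑ xs (f ∘ h)
∑-map h []       f = refl
∑-map h (x ∷ xs) f = cong (f (h x) +_) (∑-map h xs f)

∑-swap : ∀ (xs : List A) (ys : List B) (f : A → B → ℚ) →
         ∑ xs (λ x → ∑ ys (f x)) ≡ ∑ ys (λ y → ∑ xs (λ x → f x y))
∑-swap []       ys f = sym (∑-zero ys)
∑-swap (x ∷ xs) ys f = trans (cong (∑ ys (f x) +_) (∑-swap xs ys f)) (sym (∑-+ ys _ _))

∑-cartesianProductWith : ∀ (h : A → B → C) xs ys (f : C → ℚ) →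
  ∑ (cartesianProductWith h xs ys) f ≡ ∑ xs (λ x → ∑ ys (λ y → f (h x y)))
∑-cartesianProductWith h []       ys f = refl
∑-cartesianProductWith h (x ∷ xs) ys f = trans (∑-++ (List.map (h x) ys) _ f)
  (cong₂ _+_ (∑-map (h x) ys f) (∑-cartesianProductWith h xs ys f))

if-yes : (P? : Dec P) {a b : A} → P → (if does P? then a else b) ≡ a
if-yes (yes _) _ = refl
if-yes (no ¬P) P = contradiction P ¬P

if-no : (P? : Dec P) {a b : A} → ¬ P → (if does P? then a else b) ≡ b
if-no (yes P) ¬P = contradiction P ¬P
if-no (no _)  _  = refl

𝟙 : Dec P → ℚ
𝟙 P? = if does P? then 1ℚ else 0ℚ

𝟙-yes : (P? : Dec P) → P → 𝟙 P? ≡ 1ℚ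
𝟙-yes P? = if-yes P?

𝟙-no : (P? : Dec P) → ¬ P → 𝟙 P? ≡ 0ℚ
𝟙-no P? = if-no P?

𝟙-⇔ : (P? : Dec P) (Q? : Dec Q) → (P → Q) → (Q → P) → 𝟙 P? ≡ 𝟙 Q?
𝟙-⇔ (yes P) Q? f g = sym (𝟙-yes Q? (f P))
𝟙-⇔ (no ¬P) Q? f g = sym (𝟙-no Q? (¬P ∘ g))

𝟙-× : (P? : Dec P) (Q? : Dec Q) → 𝟙 (P? ×-dec Q?) ≡ 𝟙 P? * 𝟙 Q?
𝟙-× (yes _) Q? = sym (ℚ.*-identityˡ (𝟙 Q?))
𝟙-× (no _)  Q? = sym (ℚ.*-zeroˡ (𝟙 Q?))

𝟙-cong-* : (P? : Dec P) {a b : ℚ} → (P → a ≡ b) → 𝟙 P? * a ≡ 𝟙 P? * b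
𝟙-cong-* (yes P) a≡b = cong (1ℚ *_) (a≡b P)
𝟙-cong-* (no _) {a} {b} a≡b = trans (ℚ.*-zeroˡ a) (sym (ℚ.*-zeroˡ b))

∑-filter : ∀ {P : A → Set} (P? : Decidable P) xs (f : A → ℚ) →
           ∑ (filter P? xs) f ≡ ∑ xs (λ x → 𝟙 (P? x) * f x)
∑-filter P? []       f = refl
∑-filter P? (x ∷ xs) f with does (P? x)
... | true  = cong₂ _+_ (sym (ℚ.*-identityˡ (f x))) (∑-filter P? xs f)
... | false = trans (∑-filter P? xs f)
                (sym (trans (cong (_+ _) (ℚ.*-zeroˡ (f x))) (ℚ.+-identityˡ _)))

-- The fraction `+ n / 1` is normalised through a gcd that does not reduce for a variable `n`, so
-- the identity is checked among unnormalised rationals.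
fromℕ-suc : ∀ n → fromℕ (suc n) ≡ 1ℚ + fromℕ n
fromℕ-suc n = ℚ.toℚᵘ-injective
  (ℚᵘ.≃-trans (ℚ.toℚᵘ-fromℚᵘ (ℚᵘ.mkℚᵘ (ℤ.+ suc n) 0))
  (ℚᵘ.≃-trans (ℚᵘ.≃-reflexive (cong (λ k → ℚᵘ.mkℚᵘ (ℤ.1ℤ ℤ.+ k) 0) (sym (ℤ.*-identityʳ (ℤ.+ n)))))
  (ℚᵘ.≃-trans (ℚᵘ.+-congʳ ℚᵘ.1ℚᵘ (ℚᵘ.≃-sym (ℚ.toℚᵘ-fromℚᵘ (ℚᵘ.mkℚᵘ (ℤ.+ n) 0))))
  (ℚᵘ.≃-sym (ℚ.toℚᵘ-homo-+ 1ℚ (fromℕ n))))))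

fromℕ-length : ∀ (xs : List A) → fromℕ (length xs) ≡ ∑ xs (λ _ → 1ℚ)
fromℕ-length []       = refl
fromℕ-length (x ∷ xs) = trans (fromℕ-suc (length xs)) (cong (1ℚ +_) (fromℕ-length xs))

fromℕ-suc≢0 : ∀ n → fromℕ (suc n) ≢ 0ℚ
fromℕ-suc≢0 n eq with ℚᵘ.≃-trans (ℚᵘ.≃-sym (ℚ.toℚᵘ-fromℚᵘ (ℚᵘ.mkℚᵘ (ℤ.+ suc n) 0))) (ℚ.toℚᵘ-cong eq)
... | ℚᵘ.*≡* ()

*-cancel-≢0 : ∀ {a b : ℚ} → a ≢ 0ℚ → a * b ≡ 0ℚ → b ≡ 0ℚ
*-cancel-≢0 {a} {b} a≢0 ab≡0 = begin
  b                  ≡⟨ ℚ.*-identityˡ b ⟨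
  1ℚ * b             ≡⟨ cong (_* b) (ℚ.*-inverseˡ a) ⟨
  (ℚ.1/ a) * a * b   ≡⟨ ℚ.*-assoc (ℚ.1/ a) a b ⟩
  (ℚ.1/ a) * (a * b) ≡⟨ cong ((ℚ.1/ a) *_) ab≡0 ⟩
  (ℚ.1/ a) * 0ℚ      ≡⟨ ℚ.*-zeroʳ (ℚ.1/ a) ⟩
  0ℚ                 ∎
  where instance _ = ℚ.≢-nonZero a≢0

∏-one : ∀ {n} (f : Fin n → ℚ) → (∀ v → f v ≡ 1ℚ) → ∏ f ≡ 1ℚ
∏-one {zero}  f f≡1 = refl
∏-one {suc n} f f≡1 = trans (cong₂ _*_ (f≡1 zero) (∏-one (f ∘ suc) (f≡1 ∘ suc))) (ℚ.*-identityˡ 1ℚ)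

∏-zero : ∀ {n} (f : Fin n → ℚ) v → f v ≡ 0ℚ → ∏ f ≡ 0ℚ
∏-zero f zero    fv≡0 = trans (cong (_* ∏ (f ∘ suc)) fv≡0) (ℚ.*-zeroˡ (∏ (f ∘ suc)))
∏-zero f (suc v) fv≡0 = trans (cong (f zero *_) (∏-zero (f ∘ suc) v fv≡0)) (ℚ.*-zeroʳ (f zero))

∏-𝟙-yes : ∀ {n} {P : Fin n → Set} (P? : Decidable P) → (∀ v → P v) → ∏ (λ v → 𝟙 (P? v)) ≡ 1ℚ
∏-𝟙-yes P? Pv = ∏-one _ λ v → 𝟙-yes (P? v) (Pv v)

𝟙-all : ∀ {n} {P : Fin n → Set} (P? : Decidable P) (∀P? : Dec (∀ v → P v)) →
        𝟙 ∀P? ≡ ∏ (λ v → 𝟙 (P? v))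
𝟙-all             P? (yes ∀P) = sym (∏-𝟙-yes P? ∀P)
𝟙-all {n} {P = P} P? (no ¬∀P) = sym (search n P? ¬∀P)
  where
  search : ∀ n {P : Fin n → Set} (P? : Decidable P) → ¬ (∀ v → P v) → ∏ (λ v → 𝟙 (P? v)) ≡ 0ℚ
  search zero    P? ¬∀P = ⊥-elim (¬∀P λ ())
  search (suc n) P? ¬∀P with P? zero
  ... | no  _  = ℚ.*-zeroˡ (∏ λ v → 𝟙 (P? (suc v)))
  ... | yes P₀ = trans (ℚ.*-identityˡ (∏ λ v → 𝟙 (P? (suc v))))
    (search n (P? ∘ suc) λ P₊ → ¬∀P λ { zero → P₀ ; (suc v) → P₊ v })

∏-if : ∀ {n} {P : A → Set} (P? : Decidable P) (t : ℚ) (f : Fin n → A) →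
       ∏ (λ v → if does (P? (f v)) then t else 1ℚ) ≡ t ^ length (filter P? (List.tabulate f))
∏-if {n = zero}  P? t f = refl
∏-if {n = suc n} P? t f with does (P? (f zero))
... | true  = cong (t *_) (∏-if P? t (f ∘ suc))
... | false = trans (ℚ.*-identityˡ (∏ λ v → if does (P? (f (suc v))) then t else 1ℚ)) (∏-if P? t (f ∘ suc))

-- Sums over tuples

∑-tuples : ∀ n (as : List A) (f : Vec A (suc n) → ℚ) →
           ∑ (tuples (suc n) as) f ≡ ∑ as (λ a → ∑ (tuples n as) (λ v → f (a ∷ v)))
∑-tuples n as f = ∑-cartesianProductWith _∷_ as (tuples n as) f

∑-tuples-cong : ∀ {n} {as : List A} {P : A → Set} → All P as → {f g : Vec A n → ℚ} →
  (∀ v → (∀ i → P (lookup v i)) → f v ≡ g v) → ∑ (tuples n as) f ≡ ∑ (tuples n as) g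
∑-tuples-cong {n = zero}            ps f≡g = cong (_+ 0ℚ) (f≡g [] λ ())
∑-tuples-cong {n = suc n} {as = as} ps f≡g = trans (∑-tuples n as _) (trans
  (∑-cong-∈ as λ a a∈as → ∑-tuples-cong ps λ v pv →
    f≡g (a ∷ v) λ { zero → All.lookup ps a∈as ; (suc i) → pv i })
  (sym (∑-tuples n as _)))

-- Distributivity. It reduces a sum over all choices, one per vertex or one per edge, to a separate
-- small sum at each vertex or edge.
∑-tuples-∏ : ∀ {n} (as : List A) (f : Fin n → A → ℚ) →
  ∑ (tuples n as) (λ v → ∏ (λ i → f i (lookup v i))) ≡ ∏ (λ i → ∑ as (f i))
∑-tuples-∏ {n = zero}  as f = refl
∑-tuples-∏ {n = suc n} as f = trans (∑-tuples n as _) (trans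
  (∑-cong as λ a → trans (∑-*ˡ (tuples n as) (f zero a) _)
    (cong (f zero a *_) (∑-tuples-∏ as (f ∘ suc))))
  (∑-*ʳ as _ (f zero)))

-- That a occurs exactly once in as, tested on sums over as.
Once : A → List A → Set
Once a as = ∀ (f : _ → ℚ) → (∀ b → b ≢ a → f b ≡ 0ℚ) → ∑ as f ≡ f a

unique⇒once : ∀ {a : A} {as} → Unique as → a ∈ as → Once a as
unique⇒once {a = a} {as = b ∷ as} (b∉as ∷ u) (here refl) f f≡0 = trans
  (cong (f a +_) (trans
    (∑-cong-∈ as λ c c∈as → f≡0 c λ c≡a → All.lookup b∉as c∈as (sym c≡a))
    (∑-zero as)))
  (ℚ.+-identityʳ (f a))
unique⇒once {a = a} {as = b ∷ as} (b∉as ∷ u) (there a∈as) f f≡0 = trans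
  (cong₂ _+_ (f≡0 b (All.lookup b∉as a∈as)) (unique⇒once u a∈as f f≡0))
  (ℚ.+-identityˡ (f a))

once-tuples : ∀ {n} {as : List A} (v : Vec A n) → (∀ i → Once (lookup v i) as) → Once v (tuples n as)
once-tuples {as = as} []      once f f≡0 = ℚ.+-identityʳ (f [])
once-tuples {n = suc n} {as} (a ∷ v) once f f≡0 = trans (∑-tuples _ as f) (trans
  (once zero _ λ b b≢a → trans
    (∑-cong (tuples n as) λ w → f≡0 (b ∷ w) (b≢a ∘ Vec.∷-injectiveˡ)) (∑-zero (tuples n as)))
  (once-tuples v (once ∘ suc) (λ w → f (a ∷ w)) λ w w≢v → f≡0 (a ∷ w) (w≢v ∘ Vec.∷-injectiveʳ)))

-- Polynomial functions and their extrapolation to 0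

Δ : (ℕ → ℚ) → ℕ → ℚ
Δ f j = f (suc j) - f j

-- Degree less than d: the d-th iterated difference vanishes.
data Poly : ℕ → (ℕ → ℚ) → Set where
  vanishing  : ∀ {f} → (∀ j → f j ≡ 0ℚ) → Poly zero f
  difference : ∀ {d f} → Poly d (Δ f) → Poly (suc d) f

IsPolynomial : (ℕ → ℚ) → Set
IsPolynomial f = ∃[ d ] Poly d f

poly-cong : ∀ {d f g} → f ≗ g → Poly d f → Poly d g
poly-cong f≗g (vanishing f≡0)  = vanishing λ j → trans (sym (f≗g j)) (f≡0 j)
poly-cong f≗g (difference pΔf) = difference (poly-cong (λ j → cong₂ _-_ (f≗g (suc j)) (f≗g j)) pΔf)

poly-zero : ∀ d → Poly d (λ _ → 0ℚ)
poly-zero zero    = vanishing λ _ → refl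
poly-zero (suc d) = difference (poly-zero d)

poly-suc : ∀ {d f} → Poly d f → Poly (suc d) f
poly-suc (vanishing f≡0)  = difference (vanishing λ j → cong₂ _-_ (f≡0 (suc j)) (f≡0 j))
poly-suc (difference pΔf) = difference (poly-suc pΔf)

poly-raise : ∀ {d f} k → Poly d f → Poly (k ℕ.+ d) f
poly-raise zero    pf = pf
poly-raise (suc k) pf = poly-suc (poly-raise k pf)

poly-+ : ∀ {d f g} → Poly d f → Poly d g → Poly d (λ j → f j + g j)
poly-+ (vanishing f≡0) (vanishing g≡0) = vanishing λ j → cong₂ _+_ (f≡0 j) (g≡0 j)
poly-+ {f = f} {g} (difference pΔf) (difference pΔg) = difference (poly-cong
  (λ j → solve 4 (λ f₁ f₀ g₁ g₀ → (f₁ :- f₀) :+ (g₁ :- g₀) := (f₁ :+ g₁) :- (f₀ :+ g₀)) refl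
    (f (suc j)) (f j) (g (suc j)) (g j))
  (poly-+ pΔf pΔg))

poly-shift : ∀ {d f} → Poly d f → Poly d (f ∘ suc)
poly-shift (vanishing f≡0)  = vanishing (f≡0 ∘ suc)
poly-shift (difference pΔf) = difference (poly-shift pΔf)

-- Induction on both degrees by the product rule `Δ (f g) j = Δ f j · g (j + 1) + f j · Δ g
-- j`. The bound `a + b` is not sharp, but it fits the recursion.
poly-* : ∀ {a b f g} → Poly a f → Poly b g → Poly (a ℕ.+ b) (λ j → f j * g j)
poly-* {b = b} {g = g} (vanishing f≡0) pg = poly-cong
  (λ j → sym (trans (cong (_* g j) (f≡0 j)) (ℚ.*-zeroˡ (g j)))) (poly-zero b)
poly-* {a = a} {f = f} (difference _) (vanishing g≡0) = poly-cong
  (λ j → sym (trans (cong (f j *_) (g≡0 j)) (ℚ.*-zeroʳ (f j)))) (poly-zero (a ℕ.+ 0))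
poly-* {suc a} {suc b} {f} {g} pf@(difference pΔf) pg@(difference pΔg) = difference (poly-cong
  (λ j → solve 4 (λ f₁ f₀ g₁ g₀ → (f₁ :- f₀) :* g₁ :+ f₀ :* (g₁ :- g₀) := f₁ :* g₁ :- f₀ :* g₀) refl
    (f (suc j)) (f j) (g (suc j)) (g j))
  (poly-+ (poly-* pΔf (poly-shift pg))
    (subst (λ d → Poly d (λ j → f j * Δ g j)) (sym (ℕ.+-suc a b)) (poly-* pf pΔg))))

-- One step back is `f 0 = f 1 - Δ f 0`, and `Δ f`, of smaller degree, vanishes at the positive
-- arguments too.
poly-extrapolate : ∀ {d f} → Poly d f → (∀ j → f (suc j) ≡ 0ℚ) → f 0 ≡ 0ℚ
poly-extrapolate         (vanishing f≡0)  f₊≡0 = f≡0 0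
poly-extrapolate {f = f} (difference pΔf) f₊≡0 = begin
  f 0                 ≡⟨ solve 2 (λ x y → y := x :- (x :- y)) refl (f 1) (f 0) ⟩
  f 1 - Δ f 0         ≡⟨ cong₂ _-_ (f₊≡0 0) (poly-extrapolate pΔf λ j → cong₂ _-_ (f₊≡0 (suc j)) (f₊≡0 j)) ⟩
  0ℚ                  ∎

polynomial-cong : ∀ {f g : ℕ → ℚ} → f ≗ g → IsPolynomial f → IsPolynomial g
polynomial-cong f≗g (d , pf) = d , poly-cong f≗g pf

polynomial-const : ∀ c → IsPolynomial (λ _ → c)
polynomial-const c = 1 , difference (vanishing λ _ → ℚ.+-inverseʳ c)

polynomial-+ : ∀ {f g : ℕ → ℚ} → IsPolynomial f → IsPolynomial g → IsPolynomial (λ j → f j + g j)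
polynomial-+ {g = g} (a , pf) (b , pg) = b ℕ.+ a ,
  poly-+ (poly-raise b pf) (subst (λ d → Poly d g) (ℕ.+-comm a b) (poly-raise a pg))

polynomial-* : ∀ {f g : ℕ → ℚ} → IsPolynomial f → IsPolynomial g → IsPolynomial (λ j → f j * g j)
polynomial-* (a , pf) (b , pg) = a ℕ.+ b , poly-* pf pg

polynomial-∑ : ∀ (xs : List A) {f : A → ℕ → ℚ} → (∀ x → IsPolynomial (f x)) →
               IsPolynomial (λ j → ∑ xs (λ x → f x j))
polynomial-∑ []       pf = 0 , poly-zero 0
polynomial-∑ (x ∷ xs) pf = polynomial-+ (pf x) (polynomial-∑ xs pf)

-- Functions given by a recursion in `j`, such as `eValue` and `extrapolated`, become polynomial
-- through this step: the recursion expresses their difference by simpler functions.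
polynomial-from-Δ : ∀ {f : ℕ → ℚ} → IsPolynomial (Δ f) → IsPolynomial f
polynomial-from-Δ (d , pf) = suc d , difference pf

polynomial-fromℕ : IsPolynomial fromℕ
polynomial-fromℕ = polynomial-from-Δ (polynomial-cong
  (λ j → sym (trans (cong (_- fromℕ j) (fromℕ-suc j))
    (solve 1 (λ x → (con 1ℚ :+ x) :- x := con 1ℚ) refl (fromℕ j))))
  (polynomial-const 1ℚ))

polynomial-^ : ∀ {f : ℕ → ℚ} → IsPolynomial f → ∀ k → IsPolynomial (λ j → f j ^ k)
polynomial-^ pf zero    = polynomial-const 1ℚ
polynomial-^ pf (suc k) = polynomial-* pf (polynomial-^ pf k)

extrapolate : ∀ {f g : ℕ → ℚ} → IsPolynomial f → IsPolynomial g →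
              (∀ j → f (suc j) ≡ g (suc j)) → f 0 ≡ g 0
extrapolate {f} {g} pf pg f≡g = begin
  f 0                    ≡⟨ solve 2 (λ x y → x := (x :+ con (- 1ℚ) :* y) :+ y) refl (f 0) (g 0) ⟩
  f 0 + - 1ℚ * g 0 + g 0 ≡⟨ cong (_+ g 0) (poly-extrapolate (proj₂ pf-g) λ j → trans
                              (cong (_+ - 1ℚ * g (suc j)) (f≡g j))
                              (solve 1 (λ y → y :+ con (- 1ℚ) :* y := con 0ℚ) refl (g (suc j)))) ⟩
  0ℚ + g 0               ≡⟨ ℚ.+-identityˡ (g 0) ⟩
  g 0                    ∎
  where
  pf-g = polynomial-+ pf (polynomial-* (polynomial-const (- 1ℚ)) pg)

-- Induction on `k`. Setting the variable to 0 isolates the constant coefficient; once it is known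
-- to vanish, the sum can be divided by the variable. The quotient vanishes at positive integers,
-- hence by extrapolation also at 0.
coefficients-vanish : ∀ (xs : List A) (c : A → ℚ) (d : A → ℕ) →
  (∀ j → ∑ xs (λ x → c x * fromℕ j ^ d x) ≡ 0ℚ) →
  ∀ k → ∑ xs (λ x → c x * 𝟙 (d x ℕ.≟ k)) ≡ 0ℚ
coefficients-vanish xs c d vanish zero = trans (∑-cong xs λ x → cong (c x *_) (𝟙≡0^ (d x))) (vanish 0)
  where
  𝟙≡0^ : ∀ n → 𝟙 (n ℕ.≟ 0) ≡ 0ℚ ^ n
  𝟙≡0^ zero    = refl
  𝟙≡0^ (suc n) = sym (ℚ.*-zeroˡ (0ℚ ^ n))
coefficients-vanish xs c d vanish (suc k) =
  trans (∑-cong xs λ x → shift-𝟙 (c x) (d x)) (coefficients-vanish xs c′ d′ vanish′ k)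
  where
  -- Constant terms stay in the list with coefficient 0; otherwise `pred` would confuse the
  -- exponents 0 and 1.
  positive : ℚ → ℕ → ℚ
  positive a zero    = 0ℚ
  positive a (suc _) = a
  c′ = λ x → positive (c x) (d x)
  d′ = λ x → ℕ.pred (d x)
  shift-𝟙 : ∀ a n → a * 𝟙 (n ℕ.≟ suc k) ≡ positive a n * 𝟙 (ℕ.pred n ℕ.≟ k)
  shift-𝟙 a zero    = trans (ℚ.*-zeroʳ a) (sym (ℚ.*-zeroˡ (𝟙 (0 ℕ.≟ k))))
  shift-𝟙 a (suc n) = cong (a *_) (𝟙-⇔ (suc n ℕ.≟ suc k) (n ℕ.≟ k) ℕ.suc-injective (cong suc))
  S′ = λ j → ∑ xs (λ x → c′ x * fromℕ j ^ d′ x)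
  split : ∀ t a n → a * t ^ n ≡ t * (positive a n * t ^ ℕ.pred n) + a * 𝟙 (n ℕ.≟ 0)
  split t a zero    = solve 2 (λ t a → a :* con 1ℚ := t :* (con 0ℚ :* con 1ℚ) :+ a :* con 1ℚ) refl t a
  split t a (suc n) = solve 3 (λ t a u → a :* (t :* u) := t :* (a :* u) :+ a :* con 0ℚ) refl t a (t ^ n)
  vanish₊ : ∀ j → S′ (suc j) ≡ 0ℚ
  vanish₊ j = *-cancel-≢0 (fromℕ-suc≢0 j) (begin
    t * S′ (suc j)                    ≡⟨ ℚ.+-identityʳ (t * S′ (suc j)) ⟨
    t * S′ (suc j) + 0ℚ               ≡⟨ cong₂ _+_ (sym (∑-*ˡ xs t (λ x → c′ x * t ^ d′ x))) (sym (coefficients-vanish xs c d vanish 0)) ⟩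
    ∑ xs (λ x → t * (c′ x * t ^ d′ x)) + ∑ xs (λ x → c x * 𝟙 (d x ℕ.≟ 0))
                                      ≡⟨ ∑-+ xs _ _ ⟨
    ∑ xs (λ x → t * (c′ x * t ^ d′ x) + c x * 𝟙 (d x ℕ.≟ 0))
                                      ≡⟨ ∑-cong xs (λ x → split t (c x) (d x)) ⟨
    ∑ xs (λ x → c x * t ^ d x)        ≡⟨ vanish (suc j) ⟩
    0ℚ                                ∎)
    where t = fromℕ (suc j)
  vanish′ : ∀ j → S′ j ≡ 0ℚ
  vanish′ (suc j) = vanish₊ j
  vanish′ zero    = extrapolate
    (polynomial-∑ xs λ x → polynomial-* (polynomial-const (c′ x)) (polynomial-^ polynomial-fromℕ (d′ x)))
    (polynomial-const 0ℚ) vanish₊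

-- Evaluation of series

infix 4 _≟ᵛ_
_≟ᵛ_ : ∀ {n} → DecidableEquality (Vec ℕ n)
_≟ᵛ_ = Vec.≡-dec ℕ._≟_

_⊕_ : ∀ {n} → Vec ℕ n → Vec ℕ n → Vec ℕ n
_⊕_ = Vec.zipWith ℕ._+_

-- Only the split with first part `b` can contribute. It exists if `b ≤ a`, where truncated
-- subtraction is honest; for `b > a` both sides are 0.
∑-splitℕ : ∀ a b c → ∑ (splitℕ a) (λ p → 𝟙 (b ℕ.≟ proj₁ p) * 𝟙 (c ℕ.≟ proj₂ p)) ≡ 𝟙 (b ℕ.+ c ℕ.≟ a)
∑-splitℕ a b c = trans (∑-map (λ k → k , a ℕ.∸ k) (List.upTo (suc a)) (λ p → 𝟙 (b ℕ.≟ proj₁ p) * 𝟙 (c ℕ.≟ proj₂ p))) (go (b ℕ.<? suc a))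
  where
  F : ℕ → ℚ
  F k = 𝟙 (b ℕ.≟ k) * 𝟙 (c ℕ.≟ a ℕ.∸ k)
  F≡0 : ∀ k → k ≢ b → F k ≡ 0ℚ
  F≡0 k k≢b = trans (cong (_* 𝟙 (c ℕ.≟ a ℕ.∸ k)) (𝟙-no (b ℕ.≟ k) (k≢b ∘ sym))) (ℚ.*-zeroˡ (𝟙 (c ℕ.≟ a ℕ.∸ k)))
  go : Dec (b ℕ.< suc a) → ∑ (List.upTo (suc a)) F ≡ 𝟙 (b ℕ.+ c ℕ.≟ a)
  go (yes b≤a) = begin
    ∑ (List.upTo (suc a)) F    ≡⟨ unique⇒once (Unique.upTo⁺ (suc a)) (∈.∈-upTo⁺ b≤a) F F≡0 ⟩
    F b                        ≡⟨ cong (_* 𝟙 (c ℕ.≟ a ℕ.∸ b)) (𝟙-yes (b ℕ.≟ b) refl) ⟩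
    1ℚ * 𝟙 (c ℕ.≟ a ℕ.∸ b)     ≡⟨ ℚ.*-identityˡ _ ⟩
    𝟙 (c ℕ.≟ a ℕ.∸ b)          ≡⟨ 𝟙-⇔ (c ℕ.≟ a ℕ.∸ b) (b ℕ.+ c ℕ.≟ a)
                                    (λ { refl → ℕ.m+[n∸m]≡n (ℕ.≤-pred b≤a) })
                                    (λ { refl → sym (ℕ.m+n∸m≡n b c) }) ⟩
    𝟙 (b ℕ.+ c ℕ.≟ a)          ∎
  go (no b≰a) = trans
    (∑-cong-∈ (List.upTo (suc a)) λ k k∈ → F≡0 k λ { refl → b≰a (∈.∈-upTo⁻ k∈) })
    (trans (∑-zero (List.upTo (suc a)))
      (sym (𝟙-no (b ℕ.+ c ℕ.≟ a) λ { refl → b≰a (ℕ.s≤s (ℕ.m≤m+n b c)) })))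

𝟙-∷ : ∀ {n} a b (α β : Vec ℕ n) → 𝟙 (a ∷ α ≟ᵛ b ∷ β) ≡ 𝟙 (a ℕ.≟ b) * 𝟙 (α ≟ᵛ β)
𝟙-∷ a b α β = trans
  (𝟙-⇔ (a ∷ α ≟ᵛ b ∷ β) (a ℕ.≟ b ×-dec α ≟ᵛ β) Vec.∷-injective λ { (refl , refl) → refl })
  (𝟙-× (a ℕ.≟ b) (α ≟ᵛ β))

-- This is `x^β · x^γ = x^(β + γ)` for the convolution product, read off at `x^α`; the coordinates
-- split independently.
∑-splits : ∀ {n} (α β γ : Vec ℕ n) →
  ∑ (splits α) (λ p → 𝟙 (β ≟ᵛ proj₁ p) * 𝟙 (γ ≟ᵛ proj₂ p)) ≡ 𝟙 (β ⊕ γ ≟ᵛ α)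
∑-splits []      []      []      = refl
∑-splits (a ∷ α) (b ∷ β) (c ∷ γ) = begin
  ∑ (splits (a ∷ α)) (λ p → 𝟙 (b ∷ β ≟ᵛ proj₁ p) * 𝟙 (c ∷ γ ≟ᵛ proj₂ p))
    ≡⟨ ∑-cartesianProductWith _ (splitℕ a) (splits α) _ ⟩
  ∑ (splitℕ a) (λ p → ∑ (splits α) (λ r →
    𝟙 (b ∷ β ≟ᵛ proj₁ p ∷ proj₁ r) * 𝟙 (c ∷ γ ≟ᵛ proj₂ p ∷ proj₂ r)))
    ≡⟨ ∑-cong (splitℕ a) (λ p → trans
         (∑-cong (splits α) λ r → trans
           (cong₂ _*_ (𝟙-∷ b (proj₁ p) β (proj₁ r)) (𝟙-∷ c (proj₂ p) γ (proj₂ r)))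
           (solve 4 (λ w x y z → (w :* x) :* (y :* z) := (w :* y) :* (x :* z)) refl
             (𝟙 (b ℕ.≟ proj₁ p)) (𝟙 (β ≟ᵛ proj₁ r)) (𝟙 (c ℕ.≟ proj₂ p)) (𝟙 (γ ≟ᵛ proj₂ r))))
         (trans (∑-*ˡ (splits α) (w p) _) (cong (w p *_) (∑-splits α β γ)))) ⟩
  ∑ (splitℕ a) (λ p → 𝟙 (b ℕ.≟ proj₁ p) * 𝟙 (c ℕ.≟ proj₂ p) * 𝟙 (β ⊕ γ ≟ᵛ α))
    ≡⟨ ∑-*ʳ (splitℕ a) (𝟙 (β ⊕ γ ≟ᵛ α)) w ⟩
  ∑ (splitℕ a) (λ p → 𝟙 (b ℕ.≟ proj₁ p) * 𝟙 (c ℕ.≟ proj₂ p)) * 𝟙 (β ⊕ γ ≟ᵛ α)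
    ≡⟨ cong (_* 𝟙 (β ⊕ γ ≟ᵛ α)) (∑-splitℕ a b c) ⟩
  𝟙 (b ℕ.+ c ℕ.≟ a) * 𝟙 (β ⊕ γ ≟ᵛ α)
    ≡⟨ 𝟙-∷ (b ℕ.+ c) a (β ⊕ γ) α ⟨
  𝟙 ((b ∷ β) ⊕ (c ∷ γ) ≟ᵛ a ∷ α) ∎
  where
  w : ℕ × ℕ → ℚ
  w p = 𝟙 (b ℕ.≟ proj₁ p) * 𝟙 (c ℕ.≟ proj₂ p)

monomialValue : (Generator → ℚ) → List Generator → ℚ
monomialValue val = List.foldr (λ g → val g *_) 1ℚ

-- A series that is a polynomial in x_{-N} , … , x_N once the other variables are
-- set to 0 can be evaluated, given the values h of the monomials.
module Evaluation (N : ℕ) (h : Exponents N → ℚ) where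

  Terms : Set
  Terms = List (ℚ × Exponents N)

  coefficient : Terms → Exponents N → ℚ
  coefficient L α = ∑ L (λ t → proj₁ t * 𝟙 (proj₂ t ≟ᵛ α))

  value : Terms → ℚ
  value L = ∑ L (λ t → proj₁ t * h (proj₂ t))

  -- Coefficients given as a function do not exhibit a finite support. The value is therefore a
  -- relation, witnessed by a finite list of terms in which exponents may repeat.
  record HasValue (f : Series) (v : ℚ) : Set where
    constructor represent
    field
      terms        : Terms
      coefficients : ∀ α → f N α ≡ coefficient terms α
      evaluates    : value terms ≡ v

  -- Over a duplicate-free list `D` of all exponents occurring in either representation, both values
  -- become sums that depend on the coefficients alone.
  value-unique : ∀ {f g v w} → (∀ α → f N α ≡ g N α) → HasValue f v → HasValue g w → v ≡ w
  value-unique {f} {g} f≈g (represent L f≡L refl) (represent M g≡M refl) = begin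
    value L                            ≡⟨ value-support L (λ t∈L → ∈.∈-++⁺ˡ t∈L) ⟩
    ∑ D (λ α → coefficient L α * h α)  ≡⟨ ∑-cong D (λ α → cong (_* h α)
                                            (trans (sym (f≡L α)) (trans (f≈g α) (g≡M α)))) ⟩
    ∑ D (λ α → coefficient M α * h α)  ≡⟨ value-support M (λ t∈M → ∈.∈-++⁺ʳ L t∈M) ⟨
    value M                            ∎
    where
    D : List (Exponents N)
    D = List.deduplicate _≟ᵛ_ (List.map proj₂ (L ++ M))
    h-support : ∀ {t} → t ∈ L ++ M → ∑ D (λ α → 𝟙 (proj₂ t ≟ᵛ α) * h α) ≡ h (proj₂ t)
    h-support {_ , β} t∈ = trans
      (unique⇒once (DecUnique.deduplicate-! _≟ᵛ_ _) (∈.∈-deduplicate⁺ _≟ᵛ_ (∈.∈-map⁺ proj₂ t∈)) _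
        λ α α≢β → trans (cong (_* h α) (𝟙-no (β ≟ᵛ α) (α≢β ∘ sym))) (ℚ.*-zeroˡ (h α)))
      (trans (cong (_* h β) (𝟙-yes (β ≟ᵛ β) refl)) (ℚ.*-identityˡ (h β)))
    value-support : ∀ K → (∀ {t} → t ∈ K → t ∈ L ++ M) → value K ≡ ∑ D (λ α → coefficient K α * h α)
    value-support K K⊆ = begin
      value K
        ≡⟨ ∑-cong-∈ K (λ t t∈ → cong (proj₁ t *_) (sym (h-support (K⊆ t∈)))) ⟩
      ∑ K (λ t → proj₁ t * ∑ D (λ α → 𝟙 (proj₂ t ≟ᵛ α) * h α))
        ≡⟨ ∑-cong K (λ t → trans (sym (∑-*ˡ D (proj₁ t) _))
             (∑-cong D λ α → sym (ℚ.*-assoc (proj₁ t) _ (h α)))) ⟩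
      ∑ K (λ t → ∑ D (λ α → proj₁ t * 𝟙 (proj₂ t ≟ᵛ α) * h α))
        ≡⟨ ∑-swap K D _ ⟩
      ∑ D (λ α → ∑ K (λ t → proj₁ t * 𝟙 (proj₂ t ≟ᵛ α) * h α))
        ≡⟨ ∑-cong D (λ α → ∑-*ʳ K (h α) _) ⟩
      ∑ D (λ α → coefficient K α * h α) ∎

  hasValue-wordSum : ∀ ws → HasValue (wordSum ws) (∑ (ws N) (λ w → h (exponents N w)))
  hasValue-wordSum ws = represent (List.map (λ w → 1ℚ , exponents N w) (ws N))
    (λ α → trans (fromℕ-length (filter (λ w → exponents N w ≟ᵛ α) (ws N)))
        (trans (∑-filter (λ w → exponents N w ≟ᵛ α) (ws N) _)
        (trans (∑-cong (ws N) λ w → ℚ.*-comm (𝟙 (exponents N w ≟ᵛ α)) 1ℚ)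
          (sym (∑-map _ (ws N) _)))))
    (trans (∑-map _ (ws N) _) (∑-cong (ws N) λ w → ℚ.*-identityˡ (h (exponents N w))))

  hasValue-0 : HasValue 0ₛ 0ℚ
  hasValue-0 = represent [] (λ _ → refl) refl

  hasValue-+ : ∀ {f g v w} → HasValue f v → HasValue g w → HasValue (f +ₛ g) (v + w)
  hasValue-+ (represent L f≡L refl) (represent M g≡M refl) =
    represent (L ++ M) (λ α → trans (cong₂ _+_ (f≡L α) (g≡M α)) (sym (∑-++ L M _))) (∑-++ L M _)

  hasValue-· : ∀ c {f v} → HasValue f v → HasValue (c · f) (c * v)
  hasValue-· c (represent L f≡L refl) = represent
    (List.map (λ t → c * proj₁ t , proj₂ t) L)
    (λ α → trans (cong (c *_) (f≡L α)) (sym (scaled λ β → 𝟙 (β ≟ᵛ α))))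
    (scaled h)
    where
    scaled : ∀ (k : Exponents N → ℚ) →
      ∑ (List.map (λ t → c * proj₁ t , proj₂ t) L) (λ t → proj₁ t * k (proj₂ t))
      ≡ c * ∑ L (λ t → proj₁ t * k (proj₂ t))
    scaled k = trans (∑-map _ L _) (trans
      (∑-cong L λ t → ℚ.*-assoc c (proj₁ t) (k (proj₂ t))) (∑-*ˡ L c _))

  module _ (h-⊕ : ∀ β γ → h (β ⊕ γ) ≡ h β * h γ) where

    -- All pairs of terms represent the product: with the sum over the splits moved innermost,
    -- `∑-splits` gives the coefficients and multiplicativity of `h` gives the value.
    hasValue-* : ∀ {f g v w} → HasValue f v → HasValue g w → HasValue (f *ₛ g) (v * w)
    hasValue-* {f} {g} (represent L f≡L refl) (represent M g≡M refl) = represent LM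
      (λ α → begin
          ∑ (splits α) (λ r → f N (proj₁ r) * g N (proj₂ r))
            ≡⟨ ∑-cong (splits α) (λ r → trans (cong₂ _*_ (f≡L (proj₁ r)) (g≡M (proj₂ r)))
                 (∑-*-∑ (λ β → 𝟙 (β ≟ᵛ proj₁ r)) (λ γ → 𝟙 (γ ≟ᵛ proj₂ r)))) ⟩
          ∑ (splits α) (λ r → ∑ L (λ s → ∑ M (λ t →
            (proj₁ s * proj₁ t) * (𝟙 (proj₂ s ≟ᵛ proj₁ r) * 𝟙 (proj₂ t ≟ᵛ proj₂ r)))))
            ≡⟨ trans (∑-swap (splits α) L _) (∑-cong L λ s → ∑-swap (splits α) M _) ⟩
          ∑ L (λ s → ∑ M (λ t → ∑ (splits α) (λ r →
            (proj₁ s * proj₁ t) * (𝟙 (proj₂ s ≟ᵛ proj₁ r) * 𝟙 (proj₂ t ≟ᵛ proj₂ r)))))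
            ≡⟨ ∑-cong L (λ s → ∑-cong M λ t → trans (∑-*ˡ (splits α) (proj₁ s * proj₁ t) _)
                 (cong (proj₁ s * proj₁ t *_) (∑-splits α (proj₂ s) (proj₂ t)))) ⟩
          ∑ L (λ s → ∑ M (λ t → (proj₁ s * proj₁ t) * 𝟙 (proj₂ s ⊕ proj₂ t ≟ᵛ α)))
            ≡⟨ ∑-cartesianProductWith _ L M _ ⟨
          coefficient LM α ∎)
      (trans (∑-cartesianProductWith _ L M _) (trans
          (∑-cong L λ s → ∑-cong M λ t → cong (proj₁ s * proj₁ t *_) (h-⊕ (proj₂ s) (proj₂ t)))
          (sym (∑-*-∑ h h))))
      where
      LM : Terms
      LM = cartesianProductWith (λ s t → proj₁ s * proj₁ t , proj₂ s ⊕ proj₂ t) L M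
      ∑-*-∑ : ∀ (k l : Exponents N → ℚ) →
        ∑ L (λ s → proj₁ s * k (proj₂ s)) * ∑ M (λ t → proj₁ t * l (proj₂ t))
        ≡ ∑ L (λ s → ∑ M (λ t → (proj₁ s * proj₁ t) * (k (proj₂ s) * l (proj₂ t))))
      ∑-*-∑ k l = trans (sym (∑-*ʳ L _ _)) (∑-cong L λ s → trans (sym (∑-*ˡ M (proj₁ s * k (proj₂ s)) _))
        (∑-cong M λ t → solve 4 (λ a b c d → (a :* b) :* (c :* d) := (a :* c) :* (b :* d)) refl
          (proj₁ s) (k (proj₂ s)) (proj₁ t) (l (proj₂ t))))

    module _ (h-1 : h (exponents N []) ≡ 1ℚ)
             (val : Generator → ℚ) (val-correct : ∀ g → HasValue ⟦ g ⟧ᵍ (val g)) where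

      hasValue-⟦⟧ᵐ : ∀ gs → HasValue ⟦ gs ⟧ᵐ (monomialValue val gs)
      hasValue-⟦⟧ᵐ []       = subst (HasValue 1ₛ) (trans (ℚ.+-identityʳ (h (exponents N []))) h-1) (hasValue-wordSum λ _ → [] ∷ [])
      hasValue-⟦⟧ᵐ (g ∷ gs) = hasValue-* (val-correct g) (hasValue-⟦⟧ᵐ gs)

      hasValue-⟦⟧ : ∀ P → HasValue ⟦ P ⟧ (∑ P (λ t → proj₁ t * monomialValue val (proj₂ t)))
      hasValue-⟦⟧ []             = hasValue-0
      hasValue-⟦⟧ ((c , gs) ∷ P) = hasValue-+ (hasValue-· c (hasValue-⟦⟧ᵐ gs)) (hasValue-⟦⟧ P)

-- The values of the generators

palette : ℕ → List ℤ
palette m = Vec.toList (colors m)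

toList-tabulate : ∀ n (f : ℕ → A) →
  Vec.toList (Vec.tabulate {n = n} (λ i → f (Fin.toℕ i))) ≡ List.applyUpTo f n
toList-tabulate zero    f = refl
toList-tabulate (suc n) f = cong (f 0 ∷_) (toList-tabulate n (f ∘ suc))

applyUpTo-cong : ∀ n {f g : ℕ → A} → f ≗ g → List.applyUpTo f n ≡ List.applyUpTo g n
applyUpTo-cong zero    f≗g = refl
applyUpTo-cong (suc n) f≗g = cong₂ _∷_ (f≗g 0) (applyUpTo-cong n (f≗g ∘ suc))

-- As `(k + 1) - (m + 1) = k - m`, passing to `m + 1` only adds one color at either end. This is the
-- source of the peeling recursion.
palette-suc : ∀ m → palette (suc m) ≡ ℤ.-[1+ m ] ∷ palette m ++ ℤ.+ suc m ∷ []
palette-suc m = begin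
  palette (suc m)                                  ≡⟨ toList-tabulate (suc (suc m ℕ.+ suc m)) color ⟩
  color 0 ∷ List.applyUpTo (color ∘ suc) (suc m ℕ.+ suc m)
    ≡⟨ cong₂ _∷_ (ℤ.m-n≡m⊖n 0 (suc m)) (begin
      List.applyUpTo (color ∘ suc) (suc m ℕ.+ suc m)
        ≡⟨ cong (List.applyUpTo (color ∘ suc)) (ℕ.+-suc (suc m) m) ⟩
      List.applyUpTo (color ∘ suc) (suc (suc (m ℕ.+ m)))
        ≡⟨ applyUpTo-cong (suc (suc (m ℕ.+ m))) (λ k → trans (ℤ.m-n≡m⊖n (suc k) (suc m))
             (trans (ℤ.[1+m]⊖[1+n]≡m⊖n k m) (sym (ℤ.m-n≡m⊖n k m)))) ⟩
      List.applyUpTo color′ (suc (suc (m ℕ.+ m)))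
        ≡⟨ List.applyUpTo-∷ʳ color′ (suc (m ℕ.+ m)) ⟨
      List.applyUpTo color′ (suc (m ℕ.+ m)) ++ color′ (suc (m ℕ.+ m)) ∷ []
        ≡⟨ cong₂ (λ cs c → cs ++ c ∷ []) (sym (toList-tabulate (suc (m ℕ.+ m)) color′)) last-color ⟩
      palette m ++ ℤ.+ suc m ∷ [] ∎) ⟩
  ℤ.-[1+ m ] ∷ palette m ++ ℤ.+ suc m ∷ []         ∎
  where
  color color′ : ℕ → ℤ
  color  k = ℤ.+ k ℤ.- ℤ.+ suc m
  color′ k = ℤ.+ k ℤ.- ℤ.+ m
  last-color : color′ (suc (m ℕ.+ m)) ≡ ℤ.+ suc m
  last-color = trans (ℤ.m-n≡m⊖n (suc (m ℕ.+ m)) m) (trans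
    (ℤ.⊖-≥ (ℕ.m≤n+m m (suc m))) (cong ℤ.+_ (ℕ.m+n∸n≡m (suc m) m)))

∑-palette-suc : ∀ m (f : ℤ → ℚ) →
  ∑ (palette (suc m)) f ≡ f ℤ.-[1+ m ] + (∑ (palette m) f + f (ℤ.+ suc m))
∑-palette-suc m f = begin
  ∑ (palette (suc m)) f                                  ≡⟨ cong (λ cs → ∑ cs f) (palette-suc m) ⟩
  f ℤ.-[1+ m ] + ∑ (palette m ++ ℤ.+ suc m ∷ []) f       ≡⟨ cong (f ℤ.-[1+ m ] +_) (trans
                                                              (∑-++ (palette m) (ℤ.+ suc m ∷ []) f)
                                                              (cong (∑ (palette m) f +_) (ℚ.+-identityʳ (f (ℤ.+ suc m))))) ⟩
  f ℤ.-[1+ m ] + (∑ (palette m) f + f (ℤ.+ suc m))       ∎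

palette-bounded : ∀ m → All (λ x → ℤ.∣ x ∣ ℕ.≤ m) (palette m)
palette-bounded zero    = ℕ.z≤n ∷ []
palette-bounded (suc m) = subst (All _) (sym (palette-suc m))
  (ℕ.≤-refl ∷ All.++⁺ (All.map ℕ.m≤n⇒m≤1+n (palette-bounded m)) (ℕ.≤-refl ∷ []))

bounded⇒∈-palette : ∀ {m x} → ℤ.∣ x ∣ ℕ.≤ m → x ∈ palette m
bounded⇒∈-palette {zero}  {ℤ.+ zero} _ = here refl
bounded⇒∈-palette {suc m} {x} ∣x∣≤1+m = subst (x ∈_) (sym (palette-suc m)) (go x (ℕ.m≤n⇒m<n∨m≡n ∣x∣≤1+m))
  where
  go : ∀ x → ℤ.∣ x ∣ ℕ.< suc m ⊎ ℤ.∣ x ∣ ≡ suc m → x ∈ ℤ.-[1+ m ] ∷ palette m ++ ℤ.+ suc m ∷ []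
  go x            (inj₁ (ℕ.s≤s ∣x∣≤m)) = there (∈.∈-++⁺ˡ (bounded⇒∈-palette ∣x∣≤m))
  go (ℤ.+ _)      (inj₂ refl)          = there (∈.∈-++⁺ʳ (palette m) (here refl))
  go (ℤ.-[1+ _ ]) (inj₂ refl)          = here refl

∈-palette⇒bounded : ∀ {m x} → x ∈ palette m → ℤ.∣ x ∣ ℕ.≤ m
∈-palette⇒bounded {m} x∈ = All.lookup (palette-bounded m) x∈

bounded⇒< : ∀ {m} x → ℤ.∣ x ∣ ℕ.≤ m → x ℤ.< ℤ.+ suc m
bounded⇒< (ℤ.+ _)      ∣x∣≤m = ℤ.+<+ (ℕ.s≤s ∣x∣≤m)
bounded⇒< (ℤ.-[1+ _ ]) _     = ℤ.-<+

bounded⇒> : ∀ {m} x → ℤ.∣ x ∣ ℕ.≤ m → ℤ.-[1+ m ] ℤ.< x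
bounded⇒> (ℤ.+ _)      _     = ℤ.-<+
bounded⇒> (ℤ.-[1+ _ ]) ∣x∣≤m = ℤ.-<- ∣x∣≤m

palette-sorted : ∀ m → AllPairs ℤ._<_ (palette m)
palette-sorted zero    = [] ∷ []
palette-sorted (suc m) = subst (AllPairs ℤ._<_) (sym (palette-suc m))
  ( All.++⁺ (All.map (bounded⇒> _) (palette-bounded m)) (ℤ.-<+ ∷ [])
  ∷ AllPairs.++⁺ (palette-sorted m) ([] ∷ [])
      (All.map (λ ∣x∣≤m → bounded⇒< _ ∣x∣≤m ∷ []) (palette-bounded m)))

zero-once : ∀ m → Once (ℤ.+ 0) (palette m)
zero-once m = unique⇒once (AllPairs.map (λ x<y x≡y → ℤ.<-irrefl x≡y x<y) (palette-sorted m))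
  (bounded⇒∈-palette {m} ℕ.z≤n)

length-palette : ∀ m → length (palette m) ≡ suc (m ℕ.+ m)
length-palette m = trans (cong length (toList-tabulate (suc (m ℕ.+ m)) (λ k → ℤ.+ k ℤ.- ℤ.+ m)))
  (List.length-applyUpTo (λ k → ℤ.+ k ℤ.- ℤ.+ m) (suc (m ℕ.+ m)))

lookup-colors : ∀ N i → lookup (colors N) i ≡ ℤ.+ Fin.toℕ i ℤ.- ℤ.+ N
lookup-colors N = Vec.lookup∘tabulate (λ k → ℤ.+ Fin.toℕ k ℤ.- ℤ.+ N)

lookup-colors-injective : ∀ N {i j} → lookup (colors N) i ≡ lookup (colors N) j → i ≡ j
lookup-colors-injective N {i} {j} eq = Fin.toℕ-injective (ℤ.+-injective
  (AbelianGroup.∙-cancelʳ ℤ.+-0-abelianGroup (ℤ.- ℤ.+ N) _ _ (trans (sym (lookup-colors N i)) (trans eq (lookup-colors N j)))))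

∏-single : ∀ {n} (f : Fin n → ℚ) j → (∀ i → i ≢ j → f i ≡ 1ℚ) → ∏ f ≡ f j
∏-single f zero    f≡1 = trans
  (cong (f zero *_) (∏-one (f ∘ suc) λ i → f≡1 (suc i) λ ())) (ℚ.*-identityʳ (f zero))
∏-single f (suc j) f≡1 = trans
  (cong₂ _*_ (f≡1 zero λ ()) (∏-single (f ∘ suc) j λ i i≢j → f≡1 (suc i) (i≢j ∘ Fin.suc-injective)))
  (ℚ.*-identityˡ (f (suc j)))

module _ (ξ : ℤ → ℚ) where

  monomialAt : ∀ N → Exponents N → ℚ
  monomialAt N α = ∏ λ i → ξ (lookup (colors N) i) ^ lookup α i

  wordValue : List ℤ → ℚ
  wordValue = List.foldr (λ x → ξ x *_) 1ℚ

  monomialAt-⊕ : ∀ N β γ → monomialAt N (β ⊕ γ) ≡ monomialAt N β * monomialAt N γ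
  monomialAt-⊕ N β γ = trans
    (∏-cong λ i → trans (cong (ξ (lookup (colors N) i) ^_) (Vec.lookup-zipWith ℕ._+_ i β γ))
      (^-homo-* (ξ (lookup (colors N) i)) (lookup β i) (lookup γ i)))
    (∏-distrib-* (λ i → ξ (lookup (colors N) i) ^ lookup β i) (λ i → ξ (lookup (colors N) i) ^ lookup γ i))

  -- Induction on the word: a new letter raises the exponent of exactly one variable, since the
  -- colors are distinct and each letter is among them.
  monomialAt-exponents : ∀ N {w} → All (_∈ palette N) w → monomialAt N (exponents N w) ≡ wordValue w
  monomialAt-exponents N {w} w⊆ = trans
    (∏-cong λ i → cong (ξ (lookup (colors N) i) ^_) (Vec.lookup-map i (λ c → length (filter (c ℤ.≟_) w)) (colors N)))
    (counts w w⊆)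
    where
    count : List ℤ → Fin (suc (N ℕ.+ N)) → ℕ
    count w i = length (filter (lookup (colors N) i ℤ.≟_) w)
    counts : ∀ w → All (_∈ palette N) w → ∏ (λ i → ξ (lookup (colors N) i) ^ count w i) ≡ wordValue w
    counts []      []            = ∏-one {suc (N ℕ.+ N)} _ λ i → refl
    counts (x ∷ w) (x∈ ∷ w⊆) = begin
      ∏ (λ i → ξ (lookup (colors N) i) ^ count (x ∷ w) i)   ≡⟨ ∏-cong split ⟩
      ∏ (λ i → factor i * ξ (lookup (colors N) i) ^ count w i)
        ≡⟨ ∏-distrib-* factor (λ i → ξ (lookup (colors N) i) ^ count w i) ⟩
      ∏ factor * ∏ (λ i → ξ (lookup (colors N) i) ^ count w i)  ≡⟨ cong₂ _*_ ∏-factor (counts w w⊆) ⟩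
      ξ x * wordValue w                                     ∎
      where
      factor : Fin (suc (N ℕ.+ N)) → ℚ
      factor i = if does (lookup (colors N) i ℤ.≟ x) then ξ (lookup (colors N) i) else 1ℚ
      split : ∀ i → ξ (lookup (colors N) i) ^ count (x ∷ w) i ≡ factor i * ξ (lookup (colors N) i) ^ count w i
      split i with does (lookup (colors N) i ℤ.≟ x)
      ... | true  = refl
      ... | false = sym (ℚ.*-identityˡ (ξ (lookup (colors N) i) ^ count w i))
      x∈colors = Vec∈.∈-toList⁻ x∈
      j = VecAny.index x∈colors
      colorⱼ≡x : lookup (colors N) j ≡ x
      colorⱼ≡x = sym (VecAny.lookup-index x∈colors)
      ∏-factor : ∏ factor ≡ ξ x
      ∏-factor = trans (∏-single factor j other) at-j
        where
        other : ∀ i → i ≢ j → factor i ≡ 1ℚ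
        other i i≢j with lookup (colors N) i ℤ.≟ x
        ... | yes eq = contradiction (lookup-colors-injective N (trans eq (sym colorⱼ≡x))) i≢j
        ... | no _   = refl
        at-j : factor j ≡ ξ x
        at-j with lookup (colors N) j ℤ.≟ x
        ... | yes eq = cong ξ eq
        ... | no neq = contradiction colorⱼ≡x neq

  wordValue-toList : ∀ {n} (κ : Vec ℤ n) → wordValue (Vec.toList κ) ≡ ∏ (λ v → ξ (lookup κ v))
  wordValue-toList []      = refl
  wordValue-toList (x ∷ κ) = cong (ξ x *_) (wordValue-toList κ)

  wordValue-++ : ∀ w w′ → wordValue (w ++ w′) ≡ wordValue w * wordValue w′
  wordValue-++ []      w′ = sym (ℚ.*-identityˡ (wordValue w′))
  wordValue-++ (x ∷ w) w′ = trans (cong (ξ x *_) (wordValue-++ w w′)) (sym (ℚ.*-assoc (ξ x) (wordValue w) (wordValue w′)))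

  wordValue-replicate : ∀ n x → wordValue (List.replicate n x) ≡ ξ x ^ n
  wordValue-replicate zero    x = refl
  wordValue-replicate (suc n) x = cong (ξ x *_) (wordValue-replicate n x)

-- Elementary symmetric polynomials

esym : ℕ → List ℚ → ℚ
esym zero    _       = 1ℚ
esym (suc n) []      = 0ℚ
esym (suc n) (x ∷ L) = x * esym n L + esym (suc n) L

-- In a sorted list the entries above `lo` are exactly those behind it.
∑-above : ∀ pre lo L → AllPairs ℤ._<_ (pre ++ lo ∷ L) → (g : ℤ → ℚ) →
          ∑ (pre ++ lo ∷ L) (λ x → 𝟙 (lo ℤ.<? x) * g x) ≡ ∑ L g
∑-above [] lo L (lo<L ∷ _) g = trans
  (cong₂ _+_ (trans (cong (_* g lo) (𝟙-no (lo ℤ.<? lo) (ℤ.<-irrefl refl))) (ℚ.*-zeroˡ (g lo)))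
    (∑-cong-∈ L λ x x∈ → trans (cong (_* g x) (𝟙-yes (lo ℤ.<? x) (All.lookup lo<L x∈)))
      (ℚ.*-identityˡ (g x))))
  (ℚ.+-identityˡ (∑ L g))
∑-above (y ∷ pre) lo L (y< ∷ sorted) g = trans
  (cong₂ _+_ (trans (cong (_* g y) (𝟙-no (lo ℤ.<? y) (ℤ.<-asym (All.lookup y< (∈.∈-++⁺ʳ pre (here refl))))))
      (ℚ.*-zeroˡ (g y)))
    (∑-above pre lo L sorted g))
  (ℚ.+-identityˡ (∑ L g))

module _ (ξ : ℤ → ℚ) {C : List ℤ} (C-sorted : AllPairs ℤ._<_ C) where

  -- The threshold `lo` is placed in front of the word, so that `Linked` compares the first letter
  -- with it, but it does not enter the value.
  increasing : ℕ → ℤ → ℚ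
  increasing n lo = ∑ (tuples n C) λ v → 𝟙 (linked? ℤ._<?_ (lo ∷ Vec.toList v)) * wordValue ξ (Vec.toList v)

  increasing-suc : ∀ n lo → increasing (suc n) lo ≡ ∑ C (λ x → 𝟙 (lo ℤ.<? x) * (ξ x * increasing n x))
  increasing-suc n lo = trans (∑-tuples n C _) (∑-cong C λ x → begin
    ∑ (tuples n C) (λ v → 𝟙 (linked? ℤ._<?_ (lo ∷ x ∷ Vec.toList v)) * (ξ x * wordValue ξ (Vec.toList v)))
      ≡⟨ ∑-cong (tuples n C) (λ v → trans
           (cong (_* (ξ x * wordValue ξ (Vec.toList v))) (trans
             (𝟙-⇔ (linked? ℤ._<?_ (lo ∷ x ∷ Vec.toList v)) (lo ℤ.<? x ×-dec linked? ℤ._<?_ (x ∷ Vec.toList v))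
               (λ { (lo<x ∷ l) → lo<x , l }) (λ { (lo<x , l) → lo<x ∷ l }))
             (𝟙-× (lo ℤ.<? x) (linked? ℤ._<?_ (x ∷ Vec.toList v)))))
           (solve 4 (λ a b c d → (a :* b) :* (c :* d) := (a :* c) :* (b :* d)) refl
             (𝟙 (lo ℤ.<? x)) (𝟙 (linked? ℤ._<?_ (x ∷ Vec.toList v))) (ξ x) (wordValue ξ (Vec.toList v)))) ⟩
    ∑ (tuples n C) (λ v → (𝟙 (lo ℤ.<? x) * ξ x) * (𝟙 (linked? ℤ._<?_ (x ∷ Vec.toList v)) * wordValue ξ (Vec.toList v)))
      ≡⟨ ∑-*ˡ (tuples n C) (𝟙 (lo ℤ.<? x) * ξ x) _ ⟩
    (𝟙 (lo ℤ.<? x) * ξ x) * increasing n x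
      ≡⟨ ℚ.*-assoc (𝟙 (lo ℤ.<? x)) (ξ x) (increasing n x) ⟩
    𝟙 (lo ℤ.<? x) * (ξ x * increasing n x) ∎)

  -- After the smallest letter `x` is chosen, the others come from the part of `C` behind `x`, which
  -- is the recursion of `esym`. The prefix `pre` records what has been passed, because `increasing`
  -- always sums over all of `C`.
  increasing≡esym   : ∀ n pre lo L → C ≡ pre ++ lo ∷ L → increasing n lo ≡ esym n (List.map ξ L)
  ∑-increasing≡esym : ∀ n pre L → C ≡ pre ++ L →
                      ∑ L (λ x → ξ x * increasing n x) ≡ esym (suc n) (List.map ξ L)

  increasing≡esym zero    pre lo L C≡ = refl
  increasing≡esym (suc n) pre lo L C≡ = begin
    increasing (suc n) lo                            ≡⟨ increasing-suc n lo ⟩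
    ∑ C (λ x → 𝟙 (lo ℤ.<? x) * g x)                  ≡⟨ cong (λ D → ∑ D (λ x → 𝟙 (lo ℤ.<? x) * g x)) C≡ ⟩
    ∑ (pre ++ lo ∷ L) (λ x → 𝟙 (lo ℤ.<? x) * g x)    ≡⟨ ∑-above pre lo L (subst (AllPairs ℤ._<_) C≡ C-sorted) g ⟩
    ∑ L g                                            ≡⟨ ∑-increasing≡esym n (pre ++ lo ∷ []) L
                                                          (trans C≡ (sym (List.++-assoc pre (lo ∷ []) L))) ⟩
    esym (suc n) (List.map ξ L)                      ∎
    where
    g : ℤ → ℚ
    g x = ξ x * increasing n x

  ∑-increasing≡esym n pre []      C≡ = refl
  ∑-increasing≡esym n pre (x ∷ L) C≡ = cong₂ _+_
    (cong (ξ x *_) (increasing≡esym n pre x L C≡))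
    (∑-increasing≡esym n (pre ++ x ∷ []) L (trans C≡ (sym (List.++-assoc pre (x ∷ []) L))))

  linkedSum≡esym : ∀ n → ∑ (filter (linked? ℤ._<?_) (List.map Vec.toList (tuples n C))) (wordValue ξ)
                         ≡ esym n (List.map ξ C)
  linkedSum≡esym zero    = refl
  linkedSum≡esym (suc n) = begin
    ∑ (filter (linked? ℤ._<?_) (List.map Vec.toList (tuples (suc n) C))) (wordValue ξ)
      ≡⟨ ∑-filter (linked? ℤ._<?_) (List.map Vec.toList (tuples (suc n) C)) (wordValue ξ) ⟩
    ∑ (List.map Vec.toList (tuples (suc n) C)) (λ w → 𝟙 (linked? ℤ._<?_ w) * wordValue ξ w)
      ≡⟨ ∑-map Vec.toList (tuples (suc n) C) _ ⟩
    ∑ (tuples (suc n) C) (λ v → 𝟙 (linked? ℤ._<?_ (Vec.toList v)) * wordValue ξ (Vec.toList v))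
      ≡⟨ ∑-tuples n C _ ⟩
    ∑ C (λ x → ∑ (tuples n C) (λ v → 𝟙 (linked? ℤ._<?_ (x ∷ Vec.toList v)) * (ξ x * wordValue ξ (Vec.toList v))))
      ≡⟨ ∑-cong C (λ x → trans
           (∑-cong (tuples n C) λ v → solve 3 (λ a b c → a :* (b :* c) := b :* (a :* c)) refl
             (𝟙 (linked? ℤ._<?_ (x ∷ Vec.toList v))) (ξ x) (wordValue ξ (Vec.toList v)))
           (∑-*ˡ (tuples n C) (ξ x) _)) ⟩
    ∑ C (λ x → ξ x * increasing n x)
      ≡⟨ ∑-increasing≡esym n [] C refl ⟩
    esym (suc n) (List.map ξ C) ∎

-- Induction in steps of two: a pair of factors -1 cancels inside the numerator on the left and
-- among the rationals on the right.
-1ℚ^ : ∀ n → (ℤ.-1ℤ ℤ.^ n) ℚ./ 1 ≡ (- 1ℚ) ^ n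
-1ℚ^ 0             = refl
-1ℚ^ 1             = refl
-1ℚ^ (suc (suc n)) = trans (cong (ℚ._/ 1) (begin
    ℤ.-1ℤ ℤ.* (ℤ.-1ℤ ℤ.* ℤ.-1ℤ ℤ.^ n)   ≡⟨ ℤ.*-assoc ℤ.-1ℤ ℤ.-1ℤ (ℤ.-1ℤ ℤ.^ n) ⟨
    ℤ.1ℤ ℤ.* ℤ.-1ℤ ℤ.^ n                ≡⟨ ℤ.*-identityˡ (ℤ.-1ℤ ℤ.^ n) ⟩
    ℤ.-1ℤ ℤ.^ n                         ∎))
  (trans (-1ℚ^ n) (solve 1 (λ x → x := con (- 1ℚ) :* (con (- 1ℚ) :* x)) refl ((- 1ℚ) ^ n)))

[-1]^n*[-1]^n≡1 : ∀ n → (- 1ℚ) ^ n * (- 1ℚ) ^ n ≡ 1ℚ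
[-1]^n*[-1]^n≡1 zero    = refl
[-1]^n*[-1]^n≡1 (suc n) = trans
  (solve 1 (λ x → (con (- 1ℚ) :* x) :* (con (- 1ℚ) :* x) := x :* x) refl ((- 1ℚ) ^ n)) ([-1]^n*[-1]^n≡1 n)

-- The value of e_n at one variable t − 1, one variable 0 and 2 j − 1 variables −1,
-- that is the coefficient of uⁿ in (1 + (t − 1) u) (1 − u)^(2 j − 1), also for j = 0.
eValue : ℚ → ℕ → ℕ → ℚ
eValue t zero    zero          = 1ℚ
-- At `j = 0` the series is `(1 + (t - 1) u) / (1 - u) = 1 + t u + t u² + …`.
eValue t zero    (suc n)       = t
eValue t (suc j) zero          = 1ℚ
-- A step in `j` multiplies by `(1 - u)² = 1 - 2 u + u²`.
eValue t (suc j) (suc zero)    = eValue t j 1 - (1ℚ + 1ℚ)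
eValue t (suc j) (suc (suc n)) = eValue t j (suc (suc n)) - (eValue t j (suc n) + eValue t j (suc n)) + eValue t j n

eValue-zero : ∀ t j → eValue t j 0 ≡ 1ℚ
eValue-zero t zero    = refl
eValue-zero t (suc j) = refl

-- Induction on `n`: the difference in `j` involves only the coefficients `n - 1` and `n - 2`.
polynomial-eValue : ∀ t n → IsPolynomial (λ j → eValue t j n)
polynomial-eValue t 0             = polynomial-cong (sym ∘ eValue-zero t) (polynomial-const 1ℚ)
polynomial-eValue t 1             = polynomial-from-Δ (polynomial-cong
  (λ j → solve 1 (λ x → con (- (1ℚ + 1ℚ)) := (x :- con (1ℚ + 1ℚ)) :- x) refl (eValue t j 1))
  (polynomial-const (- (1ℚ + 1ℚ))))
polynomial-eValue t (suc (suc n)) = polynomial-from-Δ (polynomial-cong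
  (λ j → solve 3 (λ x y z → con (- (1ℚ + 1ℚ)) :* y :+ z := (x :- (y :+ y) :+ z) :- x) refl
    (eValue t j (suc (suc n))) (eValue t j (suc n)) (eValue t j n))
  (polynomial-+ (polynomial-* (polynomial-const (- (1ℚ + 1ℚ))) (polynomial-eValue t (suc n)))
    (polynomial-eValue t n)))

esym-two : ∀ n L → esym (suc (suc n)) (- 1ℚ ∷ - 1ℚ ∷ L)
  ≡ esym (suc (suc n)) L - (esym (suc n) L + esym (suc n) L) + esym n L
esym-two n L = solve 3 (λ x y z → con (- 1ℚ) :* (con (- 1ℚ) :* z :+ y) :+ (con (- 1ℚ) :* y :+ x)
    := x :- (y :+ y) :+ z) refl
  (esym (suc (suc n)) L) (esym (suc n) L) (esym n L)

-- Two further entries -1 multiply the generating function by `(1 - u)²`, which is one step in `j`.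
-- The base case confirms that a step from the fictitious `j = 0` yields `(1 - u) (1 + (t - 1) u)`;
-- from `n = 3` on the coefficients vanish as `t - 2 t + t`.
esym≡eValue : ∀ t m n →
  esym n (List.replicate (suc (m ℕ.+ m)) (- 1ℚ) ++ (t - 1ℚ) ∷ []) ≡ eValue t (suc m) n
esym≡eValue t zero zero                      = refl
esym≡eValue t zero (suc zero)                =
  solve 1 (λ t → con (- 1ℚ) :* con 1ℚ :+ ((t :- con 1ℚ) :* con 1ℚ :+ con 0ℚ) := t :- con (1ℚ + 1ℚ)) refl t
esym≡eValue t zero (suc (suc zero))          =
  solve 1 (λ t → con (- 1ℚ) :* ((t :- con 1ℚ) :* con 1ℚ :+ con 0ℚ) :+ ((t :- con 1ℚ) :* con 0ℚ :+ con 0ℚ)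
    := t :- (t :+ t) :+ con 1ℚ) refl t
esym≡eValue t zero (suc (suc (suc n)))       =
  solve 1 (λ t → con (- 1ℚ) :* ((t :- con 1ℚ) :* con 0ℚ :+ con 0ℚ) :+ ((t :- con 1ℚ) :* con 0ℚ :+ con 0ℚ)
    := t :- (t :+ t) :+ t) refl t
esym≡eValue t (suc m) n rewrite ℕ.+-suc m m = next n
  where
  L = List.replicate (suc (m ℕ.+ m)) (- 1ℚ) ++ (t - 1ℚ) ∷ []
  next : ∀ n → esym n (- 1ℚ ∷ - 1ℚ ∷ L) ≡ eValue t (suc (suc m)) n
  next zero          = refl
  next (suc zero)    = trans
    (solve 1 (λ x → con (- 1ℚ) :* con 1ℚ :+ (con (- 1ℚ) :* con 1ℚ :+ x) := x :- con (1ℚ + 1ℚ)) refl (esym 1 L))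
    (cong (_- (1ℚ + 1ℚ)) (esym≡eValue t m 1))
  next (suc (suc n)) = trans (esym-two n L) (cong₂ _+_
    (cong₂ (λ x y → x - (y + y)) (esym≡eValue t m (suc (suc n))) (esym≡eValue t m (suc n)))
    (esym≡eValue t m n))

generatorValue : ℚ → ℕ → Generator → ℚ
generatorValue t j e[1+ n ]       = eValue t j (suc n)
generatorValue t j q[1+ a ,1+ b ] = 1ℚ - (fromℕ j + fromℕ j)
generatorValue t j 𝕫              = 1ℚ

polynomial-generatorValue : ∀ t g → IsPolynomial (λ j → generatorValue t j g)
polynomial-generatorValue t e[1+ n ]       = polynomial-eValue t (suc n)
polynomial-generatorValue t q[1+ a ,1+ b ] = polynomial-cong
  (λ j → solve 1 (λ x → con 1ℚ :+ con (- 1ℚ) :* (x :+ x) := con 1ℚ :- (x :+ x)) refl (fromℕ j))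
  (polynomial-+ (polynomial-const 1ℚ)
    (polynomial-* (polynomial-const (- 1ℚ)) (polynomial-+ polynomial-fromℕ polynomial-fromℕ)))
polynomial-generatorValue t 𝕫              = polynomial-const 1ℚ

polynomial-monomialValue : ∀ t gs → IsPolynomial (λ j → monomialValue (generatorValue t j) gs)
polynomial-monomialValue t []       = polynomial-const 1ℚ
polynomial-monomialValue t (g ∷ gs) =
  polynomial-* (polynomial-generatorValue t g) (polynomial-monomialValue t gs)

monomialValue-0 : ∀ t gs → monomialValue (generatorValue t 0) gs ≡ t ^ eDegree gs
monomialValue-0 t []                    = refl
monomialValue-0 t (e[1+ _ ] ∷ gs)       = cong (t *_) (monomialValue-0 t gs)
monomialValue-0 t (q[1+ _ ,1+ _ ] ∷ gs) = trans (ℚ.*-identityˡ _) (monomialValue-0 t gs)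
monomialValue-0 t (𝕫 ∷ gs)              = trans (ℚ.*-identityˡ _) (monomialValue-0 t gs)

module Specialisation (t : ℚ) (m : ℕ) where

  -- Colors beyond `m + 1` would get -1 as well, but they never occur: evaluation takes place at
  -- `N = suc m`.
  ξ : ℤ → ℚ
  ξ x = if does (x ℤ.≟ ℤ.+ suc m) then t - 1ℚ else if does (x ℤ.≟ ℤ.-[1+ m ]) then 0ℚ else - 1ℚ

  ξ-top : ξ (ℤ.+ suc m) ≡ t - 1ℚ
  ξ-top = if-yes (ℤ.+ suc m ℤ.≟ ℤ.+ suc m) refl

  ξ-bottom : ξ ℤ.-[1+ m ] ≡ 0ℚ
  ξ-bottom = if-yes (ℤ.-[1+ m ] ℤ.≟ ℤ.-[1+ m ]) refl

  ξ-middle : ∀ {x} → ℤ.∣ x ∣ ℕ.≤ m → ξ x ≡ - 1ℚ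
  ξ-middle {x} ∣x∣≤m = trans
    (if-no (x ℤ.≟ ℤ.+ suc m) λ { refl → ℕ.<⇒≱ ℕ.≤-refl ∣x∣≤m })
    (if-no (x ℤ.≟ ℤ.-[1+ m ]) λ { refl → ℕ.<⇒≱ ℕ.≤-refl ∣x∣≤m })

  open Evaluation (suc m) (monomialAt ξ (suc m)) public

  InPalette : List ℤ → Set
  InPalette = All (_∈ palette (suc m))

  wordSum-value : ∀ ws → (∀ w → w ∈ ws (suc m) → InPalette w) →
                  HasValue (wordSum ws) (∑ (ws (suc m)) (wordValue ξ))
  wordSum-value ws ws⊆ = subst (HasValue (wordSum ws))
    (∑-cong-∈ (ws (suc m)) λ w w∈ → monomialAt-exponents ξ (suc m) (ws⊆ w w∈))
    (hasValue-wordSum ws)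

  colorTuples-InPalette : ∀ n {w} → w ∈ List.map Vec.toList (colorTuples n (suc m)) → InPalette w
  colorTuples-InPalette n w∈ with κ , κ∈ , refl ← ∈.∈-map⁻ Vec.toList w∈ = letters n κ κ∈
    where
    letters : ∀ n (κ : Vec ℤ n) → κ ∈ colorTuples n (suc m) → InPalette (Vec.toList κ)
    letters zero    []      _  = []
    letters (suc n) (x ∷ κ) ∈t
      with _ , _ , x∈ , κ∈ , refl ← ∈.∈-cartesianProductWith⁻ _∷_ (palette (suc m)) (colorTuples n (suc m)) ∈t
      = x∈ ∷ letters n κ κ∈

  e-value : ∀ n → HasValue (e n) (eValue t (suc m) n)
  e-value n = subst (HasValue (e n))
    (begin
      ∑ (filter (linked? ℤ._<?_) (List.map Vec.toList (colorTuples n (suc m)))) (wordValue ξ)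
        ≡⟨ linkedSum≡esym ξ (palette-sorted (suc m)) n ⟩
      esym n (List.map ξ (palette (suc m)))
        ≡⟨ cong (esym n) map-ξ-palette ⟩
      esym n (0ℚ ∷ L)
        ≡⟨ esym-0∷ n ⟩
      esym n L
        ≡⟨ esym≡eValue t m n ⟩
      eValue t (suc m) n ∎)
    (wordSum-value (λ N → filter (linked? ℤ._<?_) (List.map Vec.toList (colorTuples n N)))
      λ w w∈ → colorTuples-InPalette n (proj₁ (∈.∈-filter⁻ (linked? ℤ._<?_) w∈)))
    where
    L = List.replicate (suc (m ℕ.+ m)) (- 1ℚ) ++ (t - 1ℚ) ∷ []
    esym-0∷ : ∀ n → esym n (0ℚ ∷ L) ≡ esym n L
    esym-0∷ zero    = refl
    esym-0∷ (suc n) = solve 2 (λ x y → con 0ℚ :* x :+ y := y) refl (esym n L) (esym (suc n) L)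
    map-middle : ∀ xs → All (λ x → ℤ.∣ x ∣ ℕ.≤ m) xs → List.map ξ xs ≡ List.replicate (length xs) (- 1ℚ)
    map-middle []       []       = refl
    map-middle (x ∷ xs) (p ∷ ps) = cong₂ _∷_ (ξ-middle {x} p) (map-middle xs ps)
    map-ξ-palette : List.map ξ (palette (suc m)) ≡ 0ℚ ∷ L
    map-ξ-palette = begin
      List.map ξ (palette (suc m))
        ≡⟨ cong (List.map ξ) (palette-suc m) ⟩
      ξ ℤ.-[1+ m ] ∷ List.map ξ (palette m ++ ℤ.+ suc m ∷ [])
        ≡⟨ cong₂ _∷_ ξ-bottom (List.map-++ ξ (palette m) _) ⟩
      0ℚ ∷ List.map ξ (palette m) ++ ξ (ℤ.+ suc m) ∷ []
        ≡⟨ cong₂ (λ xs x → 0ℚ ∷ xs ++ x ∷ [])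
             (trans (map-middle (palette m) (palette-bounded m))
               (cong (λ k → List.replicate k (- 1ℚ)) (length-palette m)))
             ξ-top ⟩
      0ℚ ∷ L ∎

  size : ∑ (palette m) (λ _ → 1ℚ) ≡ (fromℕ (suc m) + fromℕ (suc m)) - 1ℚ
  size = go m
    where
    go : ∀ m → ∑ (palette m) (λ _ → 1ℚ) ≡ (fromℕ (suc m) + fromℕ (suc m)) - 1ℚ
    go zero    = refl
    go (suc m) = begin
      ∑ (palette (suc m)) (λ _ → 1ℚ)
        ≡⟨ ∑-palette-suc m (λ _ → 1ℚ) ⟩
      1ℚ + (∑ (palette m) (λ _ → 1ℚ) + 1ℚ)
        ≡⟨ cong (λ x → 1ℚ + (x + 1ℚ)) (go m) ⟩
      1ℚ + ((fromℕ (suc m) + fromℕ (suc m)) - 1ℚ + 1ℚ)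
        ≡⟨ solve 1 (λ x → con 1ℚ :+ ((x :+ x) :- con 1ℚ :+ con 1ℚ)
             := ((con 1ℚ :+ x) :+ (con 1ℚ :+ x)) :- con 1ℚ) refl (fromℕ (suc m)) ⟩
      ((1ℚ + fromℕ (suc m)) + (1ℚ + fromℕ (suc m))) - 1ℚ
        ≡⟨ cong (λ x → (x + x) - 1ℚ) (fromℕ-suc (suc m)) ⟨
      (fromℕ (suc (suc m)) + fromℕ (suc (suc m))) - 1ℚ ∎

  -- At the indices `m + 1` and `-m-1` one of the two variables is 0 and has a positive exponent.
  -- Each of the other `2 j - 1` indices contributes `u`, a power of -1, and the sign in `q` turns
  -- `u` into -1.
  q-value : ∀ a b → HasValue (q (suc a) (suc b)) (1ℚ - (fromℕ (suc m) + fromℕ (suc m)))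
  q-value a b = subst (HasValue (q (suc a) (suc b)))
    (begin
      sign * ∑ (List.map word (palette (suc m))) (wordValue ξ)
        ≡⟨ cong (sign *_) (trans (∑-map word (palette (suc m)) (wordValue ξ))
             (trans (∑-cong (palette (suc m)) wordValue-word) (∑-palette-suc m F))) ⟩
      sign * (F ℤ.-[1+ m ] + (∑ (palette m) F + F (ℤ.+ suc m)))
        ≡⟨ cong (sign *_) (cong₂ _+_ F-bottom (cong₂ _+_ (trans (∑-cong-∈ (palette m) F-middle)
             (trans (∑-*ˡ (palette m) u (λ _ → 1ℚ)) (cong (u *_) size))) F-top)) ⟩
      sign * (0ℚ + (u * ((j + j) - 1ℚ) + 0ℚ))
        ≡⟨ cong (_* (0ℚ + (u * ((j + j) - 1ℚ) + 0ℚ))) (trans (-1ℚ^ (suc a ℕ.+ suc b ℕ.+ 1))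
             (^-homo-* (- 1ℚ) (suc a ℕ.+ suc b) 1)) ⟩
      u * (- 1ℚ * 1ℚ) * (0ℚ + (u * ((j + j) - 1ℚ) + 0ℚ))
        ≡⟨ solve 2 (λ u j → u :* (con (- 1ℚ) :* con 1ℚ) :* (con 0ℚ :+ (u :* ((j :+ j) :- con 1ℚ) :+ con 0ℚ))
             := (u :* u) :* (con 1ℚ :- (j :+ j))) refl u j ⟩
      (u * u) * (1ℚ - (j + j))
        ≡⟨ cong (_* (1ℚ - (j + j))) ([-1]^n*[-1]^n≡1 (suc a ℕ.+ suc b)) ⟩
      1ℚ * (1ℚ - (j + j))
        ≡⟨ ℚ.*-identityˡ (1ℚ - (j + j)) ⟩
      1ℚ - (j + j) ∎)
    (hasValue-· sign (wordSum-value (λ N → List.map word (palette N)) letters))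
    where
    word : ℤ → List ℤ
    word i = List.replicate (suc a) i ++ List.replicate (suc b) (ℤ.- i)
    sign = (ℤ.-1ℤ ℤ.^ (suc a ℕ.+ suc b ℕ.+ 1)) ℚ./ 1
    u = (- 1ℚ) ^ (suc a ℕ.+ suc b)
    j = fromℕ (suc m)
    F : ℤ → ℚ
    F i = ξ i ^ suc a * ξ (ℤ.- i) ^ suc b
    wordValue-word : ∀ i → wordValue ξ (word i) ≡ F i
    wordValue-word i = trans (wordValue-++ ξ (List.replicate (suc a) i) (List.replicate (suc b) (ℤ.- i)))
      (cong₂ _*_ (wordValue-replicate ξ (suc a) i) (wordValue-replicate ξ (suc b) (ℤ.- i)))
    F-bottom : F ℤ.-[1+ m ] ≡ 0ℚ
    F-bottom = trans (cong (λ x → x * ξ ℤ.-[1+ m ] ^ a * ξ (ℤ.+ suc m) ^ suc b) ξ-bottom)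
      (solve 2 (λ x y → con 0ℚ :* x :* y := con 0ℚ) refl (ξ ℤ.-[1+ m ] ^ a) (ξ (ℤ.+ suc m) ^ suc b))
    F-top : F (ℤ.+ suc m) ≡ 0ℚ
    F-top = trans (cong (λ x → ξ (ℤ.+ suc m) ^ suc a * (x * ξ ℤ.-[1+ m ] ^ b)) ξ-bottom)
      (solve 2 (λ x y → x :* (con 0ℚ :* y) := con 0ℚ) refl (ξ (ℤ.+ suc m) ^ suc a) (ξ ℤ.-[1+ m ] ^ b))
    F-middle : ∀ i → i ∈ palette m → F i ≡ u * 1ℚ
    F-middle i i∈ = trans (cong₂ (λ x y → x ^ suc a * y ^ suc b) (ξ-middle {i} (∈-palette⇒bounded i∈))
        (ξ-middle {ℤ.- i} (subst (ℕ._≤ m) (sym (ℤ.∣-i∣≡∣i∣ i)) (∈-palette⇒bounded i∈))))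
      (trans (sym (^-homo-* (- 1ℚ) (suc a) (suc b))) (sym (ℚ.*-identityʳ u)))
    letters : ∀ w → w ∈ List.map word (palette (suc m)) → InPalette w
    letters w w∈ with i , i∈ , refl ← ∈.∈-map⁻ word w∈ = All.++⁺ (All.replicate⁺ (suc a) i∈)
      (All.replicate⁺ (suc b) (bounded⇒∈-palette
        (subst (ℕ._≤ suc m) (sym (ℤ.∣-i∣≡∣i∣ i)) (∈-palette⇒bounded i∈))))

  z-value : HasValue z 1ℚ
  z-value = subst (HasValue z)
    (cong (λ x → - 1ℚ * (x * 1ℚ + 0ℚ)) (ξ-middle {ℤ.+ 0} ℕ.z≤n))
    (hasValue-· (- 1ℚ) (wordSum-value (λ _ → (ℤ.+ 0 ∷ []) ∷ [])
      λ { _ (here refl) → bounded⇒∈-palette {suc m} ℕ.z≤n ∷ [] }))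

  generator-value : ∀ g → HasValue ⟦ g ⟧ᵍ (generatorValue t (suc m) g)
  generator-value e[1+ n ]       = e-value (suc n)
  generator-value q[1+ a ,1+ b ] = q-value a b
  generator-value 𝕫              = z-value

  polynomial-value : ∀ P → HasValue ⟦ P ⟧ (∑ P (λ r → proj₁ r * monomialValue (generatorValue t (suc m)) (proj₂ r)))
  polynomial-value = hasValue-⟦⟧ (monomialAt-⊕ ξ (suc m)) (monomialAt-exponents ξ (suc m) [])
    (generatorValue t (suc m)) generator-value

  X-value : ∀ G → HasValue (X G)
    (∑ (colorTuples (SignedGraph.order G) (suc m)) (λ κ → 𝟙 (proper? G κ) * ∏ (λ v → ξ (lookup κ v))))
  X-value G = subst (HasValue (X G))
    (trans (∑-map Vec.toList (filter (proper? G) κs) (wordValue ξ)) (trans (∑-filter (proper? G) κs _)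
      (∑-cong κs λ κ → cong (𝟙 (proper? G κ) *_) (wordValue-toList ξ κ))))
    (wordSum-value (λ N → List.map Vec.toList (filter (proper? G) (colorTuples n N)))
      λ w w∈ → colorTuples-InPalette n
      (let κ , κ∈ , w≡ = ∈.∈-map⁻ Vec.toList w∈ in
       subst (_∈ _) (sym w≡) (∈.∈-map⁺ Vec.toList (proj₁ (∈.∈-filter⁻ (proper? G) κ∈)))))
    where
    n  = SignedGraph.order G
    κs = colorTuples n (suc m)

-- Acyclic orientations

opposite-arrow : Arrow → Arrow
opposite-arrow toward = away
opposite-arrow away   = toward

same-or-opposite : ∀ d d′ → d′ ≡ d ⊎ d′ ≡ opposite-arrow d
same-or-opposite toward toward = inj₁ refl
same-or-opposite toward away   = inj₂ refl
same-or-opposite away   toward = inj₂ refl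
same-or-opposite away   away   = inj₁ refl

select : ∀ {n} {P : Fin n → Set} → Decidable P → Subset n
select P? = Vec.tabulate (does ∘ P?)

module _ {n} {P : Fin n → Set} (P? : Decidable P) where

  ∈-select⁺ : ∀ {v} → P v → v ∈ˢ select P?
  ∈-select⁺ {v} Pv = Vec.lookup⇒[]= v _ (trans (Vec.lookup∘tabulate (does ∘ P?) v) (does≡true (P? v)))
    where
    does≡true : (P? : Dec (P v)) → does P? ≡ true
    does≡true (yes _) = refl
    does≡true (no ¬P) = contradiction Pv ¬P

  ∈-select⁻ : ∀ {v} → v ∈ˢ select P? → P v
  ∈-select⁻ {v} v∈ = witness (P? v) (trans (sym (Vec.lookup∘tabulate (does ∘ P?) v)) (Vec.[]=⇒lookup v∈))
    where
    witness : (P? : Dec (P v)) → does P? ≡ true → P v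
    witness (yes Pv) _ = Pv

-- An entry `just d` marks a vertex to be peeled off, as a sink for `toward` and as a source for
-- `away`; `nothing` marks one that stays.
kept : ∀ {n} → Vec (Maybe Arrow) n → Subset n
kept = Vec.map is-nothing

∈-kept⁺ : ∀ {n} (c : Vec (Maybe Arrow) n) {v} → lookup c v ≡ nothing → v ∈ˢ kept c
∈-kept⁺ c {v} c≡ = Vec.lookup⇒[]= v _ (trans (Vec.lookup-map v is-nothing c) (cong is-nothing c≡))

∈-kept⁻ : ∀ {n} (c : Vec (Maybe Arrow) n) {v} → v ∈ˢ kept c → lookup c v ≡ nothing
∈-kept⁻ c {v} v∈ = is-nothing⁻ (lookup c v) (trans (sym (Vec.lookup-map v is-nothing c)) (Vec.[]=⇒lookup v∈))
  where
  is-nothing⁻ : ∀ x → is-nothing x ≡ true → x ≡ nothing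
  is-nothing⁻ nothing _ = refl

module Acyclicity (G : SignedGraph) (o : Arrows G) where
  open SignedGraph G

  Inside : Subset order → Edge → Set
  Inside U ε = ∀ h → endpoint ε h ∈ˢ U

  inside? : ∀ U ε → Dec (Inside U ε)
  inside? U ε = Fin.all? λ h → endpoint ε h Subset.∈? U

  -- Uniform U v toward says that v is a sink of the subgraph induced by U, and
  -- Uniform U v away that v is a source of it; v need not lie in U.
  Uniform : Subset order → Vertex → Arrow → Set
  Uniform U v d = ∀ ε h → Inside U ε → endpoint ε h ≡ v → arrow G o ε h ≡ d

  uniform? : ∀ U v d → Dec (Uniform U v d)
  uniform? U v d = Fin.all? λ ε → Fin.all? λ h →
    inside? U ε →-dec (endpoint ε h Fin.≟ v →-dec arrow G o ε h ≟ᵃ d)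

  ArrowIn : Subset order → Vertex → Arrow → Set
  ArrowIn U v d = ∃[ ε ] ∃[ h ] Inside U ε × endpoint ε h ≡ v × arrow G o ε h ≡ d

  arrowIn? : ∀ U v d → Dec (ArrowIn U v d)
  arrowIn? U v d = Fin.any? λ ε → Fin.any? λ h →
    inside? U ε ×-dec (endpoint ε h Fin.≟ v ×-dec arrow G o ε h ≟ᵃ d)

  ¬uniform⇒arrowIn : ∀ {U v d} → ¬ Uniform U v d → ArrowIn U v (opposite-arrow d)
  ¬uniform⇒arrowIn {U} {v} {d} ¬uniform with arrowIn? U v (opposite-arrow d)
  ... | yes found = found
  ... | no  ¬found = contradiction
    (λ ε h inside at-v → [ id , (λ eq → contradiction (ε , h , inside , at-v , eq) ¬found) ]′
      (same-or-opposite d (arrow G o ε h)))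
    ¬uniform

  arrowIn-either : ∀ d {U v} → ArrowIn U v toward × ArrowIn U v away → ArrowIn U v d
  arrowIn-either toward = proj₁
  arrowIn-either away   = proj₂

  Balanced : Subset order → Set
  Balanced W = ∀ v → v ∈ˢ W → ArrowIn W v toward × ArrowIn W v away

  balanced? : ∀ W → Dec (Balanced W)
  balanced? W = Fin.all? λ v → v Subset.∈? W →-dec (arrowIn? W v toward ×-dec arrowIn? W v away)

  -- A balanced set plays the role of the vertex set of a cycle, though it may be disconnected. In
  -- this form acyclicity makes sense for induced subgraphs and is decided by a finite search.
  AcyclicOn : Subset order → Set
  AcyclicOn U = ∀ W → W ⊆ U → Nonempty W → ¬ Balanced W

  acyclicOn? : ∀ U → Dec (AcyclicOn U)
  acyclicOn? U = map′ no-witness acyclic-witness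
    (¬? (Subset.anySubset? λ W → W Subset.⊆? U ×-dec (Subset.nonempty? W ×-dec balanced? W)))
    where
    Witness : Set
    Witness = ∃[ W ] (W ⊆ U × Nonempty W × Balanced W)
    no-witness : ¬ Witness → AcyclicOn U
    no-witness none W W⊆U W≢∅ balanced = none (W , W⊆U , W≢∅ , balanced)
    acyclic-witness : AcyclicOn U → ¬ Witness
    acyclic-witness acyclic (W , W⊆U , W≢∅ , balanced) = acyclic W W⊆U W≢∅ balanced

  PeelableAt : Subset order → Vertex → Maybe Arrow → Set
  PeelableAt U v nothing  = Unit
  PeelableAt U v (just d) = Uniform U v d

  peelableAt? : ∀ U v x → Dec (PeelableAt U v x)
  peelableAt? U v nothing  = yes tt
  peelableAt? U v (just d) = uniform? U v d

  Peelable : Subset order → Vec (Maybe Arrow) order → Set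
  Peelable U c = ∀ v → PeelableAt U v (lookup c v)

  peelable? : ∀ U c → Dec (Peelable U c)
  peelable? U c = Fin.all? λ v → peelableAt? U v (lookup c v)

  acyclicOn-peel⁻ : ∀ U c → AcyclicOn U → AcyclicOn (U ∩ kept c)
  acyclicOn-peel⁻ U c acyclic W W⊆ = acyclic W (Subset.p∩q⊆p U (kept c) ∘ W⊆)

  -- A balanced subset of `U` contains no sink and no source of `U`, so it survives the peeling.
  acyclicOn-peel⁺ : ∀ U c → Peelable U c → AcyclicOn (U ∩ kept c) → AcyclicOn U
  acyclicOn-peel⁺ U c peelable acyclic W W⊆U W≢∅ balanced = acyclic W
    (λ v∈W → Subset.x∈p∩q⁺ (W⊆U v∈W , ∈-kept⁺ c (not-peeled v∈W (lookup c _) (peelable _)))) W≢∅ balanced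
    where
    clash : ∀ {v d d′} → Uniform U v d′ → ArrowIn W v d → d ≡ d′
    clash uniform (ε , h , inside , at-v , refl) = uniform ε h (W⊆U ∘ inside) at-v
    not-peeled : ∀ {v} → v ∈ˢ W → ∀ x → PeelableAt U v x → x ≡ nothing
    not-peeled     v∈W nothing       _       = refl
    not-peeled {v} v∈W (just toward) uniform = contradiction (clash uniform (proj₂ (balanced v v∈W))) λ ()
    not-peeled {v} v∈W (just away)   uniform = contradiction (clash uniform (proj₁ (balanced v v∈W))) λ ()

  -- Cycles as closed walks and as balanced sets

  half-edges : ∀ (h h′ : Fin 2) → h′ ≡ h ⊎ h′ ≡ Fin.opposite h
  half-edges zero       zero       = inj₁ refl
  half-edges zero       (suc zero) = inj₂ refl
  half-edges (suc zero) zero       = inj₂ refl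
  half-edges (suc zero) (suc zero) = inj₁ refl

  start∈vertices : ∀ {u v} (w : Walk G u v) → u ∈ vertices G w
  start∈vertices []               = here refl
  start∈vertices (step _ _ _ _ _) = here refl

  endpoint∈vertices : ∀ {u v} (w : Walk G u v) {ε} → ε ∈ edges G w → ∀ h → endpoint ε h ∈ vertices G w
  endpoint∈vertices (step ε h refl refl w) (there ε′∈) h′ = there (endpoint∈vertices w ε′∈ h′)
  endpoint∈vertices (step ε h refl refl w) (here refl) h′ with half-edges h h′
  ... | inj₁ refl = here refl
  ... | inj₂ refl = there (start∈vertices w)

  -- The vertices visited by a cycle form a balanced set, since both ends of every edge of the walk
  -- are visited.
  acyclicOn-⊤⇒acyclic : AcyclicOn ⊤ → Acyclic G o
  acyclicOn-⊤⇒acyclic acyclic v w cycle = acyclic W Subset.⊆⊤ (v , ∈-select⁺ visited? (start∈vertices w))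
    λ u u∈W → let has-toward , has-away = cycle u (∈-select⁻ visited? u∈W) in
      arrowIn has-toward , arrowIn has-away
    where
    visited? : Decidable (_∈ vertices G w)
    visited? u = DecMembership._∈?_ Fin._≟_ u (vertices G w)
    W = select visited?
    arrowIn : ∀ {u d} → HasArrow G o (edges G w) u d → ArrowIn W u d
    arrowIn (ε , h , ε∈ , at-u , eq) = ε , h , (λ h′ → ∈-select⁺ visited? (endpoint∈vertices w ε∈ h′)) , at-u , eq

  -- Travelling ε back and forth from a visited vertex.
  detour : ∀ {a b} (w : Walk G a b) {u} → u ∈ vertices G w → ∀ ε h → endpoint ε h ≡ u →
    Σ[ w′ ∈ Walk G a b ] (∀ {η} → η ∈ edges G w → η ∈ edges G w′) × ε ∈ edges G w′ ×
      (∀ {x} → x ∈ vertices G w′ → x ∈ vertices G w ⊎ x ≡ endpoint ε (Fin.opposite h))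
  detour [] (here refl) ε h at-u =
    step ε h at-u refl (step ε (Fin.opposite h) refl (trans (cong (endpoint ε) (Fin.opposite-involutive h)) at-u) [])
    , (λ ()) , here refl
    , λ { (here refl) → inj₁ (here refl) ; (there (here refl)) → inj₂ refl ; (there (there (here refl))) → inj₁ (here refl) }
  detour w@(step _ _ _ _ _) (here refl) ε h at-u =
    step ε h at-u refl (step ε (Fin.opposite h) refl (trans (cong (endpoint ε) (Fin.opposite-involutive h)) at-u) w)
    , (λ η∈ → there (there η∈)) , here refl
    , λ { (here refl) → inj₁ (here refl) ; (there (here refl)) → inj₂ refl ; (there (there x∈)) → inj₁ x∈ }
  detour (step η h′ p q w) (there u∈) ε h at-u with w′ , old , new , visited ← detour w u∈ ε h at-u =
    step η h′ p q w′
    , (λ { (here refl) → here refl ; (there η∈) → there (old η∈) })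
    , there new
    , λ { (here refl) → inj₁ (here refl) ; (there x∈) → map₁ there (visited x∈) }

  hasArrow? : ∀ εs v d → Dec (HasArrow G o εs v d)
  hasArrow? εs v d = Fin.any? λ ε → Fin.any? λ h →
    DecMembership._∈?_ Fin._≟_ ε εs ×-dec (endpoint ε h Fin.≟ v ×-dec arrow G o ε h ≟ᵃ d)

  missing-arrow : ∀ {v} (w : Walk G v v) → ¬ IsCycle G o w →
    ∃[ u ] u ∈ vertices G w × ∃[ d ] ¬ HasArrow G o (edges G w) u d
  missing-arrow w ¬cycle = u , u∈ , missing (hasArrow? (edges G w) u toward) (hasArrow? (edges G w) u away)
    where
    both? : Decidable (λ u → HasArrow G o (edges G w) u toward × HasArrow G o (edges G w) u away)
    both? u = hasArrow? (edges G w) u toward ×-dec hasArrow? (edges G w) u away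
    found : Any (λ u → ¬ (HasArrow G o (edges G w) u toward × HasArrow G o (edges G w) u away)) (vertices G w)
    found = All.¬All⇒Any¬ both? (vertices G w) λ all → ¬cycle λ u u∈ → All.lookup all u∈
    u = proj₁ (find found)
    u∈ = proj₁ (proj₂ (find found))
    missing : Dec (HasArrow G o (edges G w) u toward) → Dec (HasArrow G o (edges G w) u away) →
              ∃[ d ] ¬ HasArrow G o (edges G w) u d
    missing (no ¬t) _       = toward , ¬t
    missing (yes t) (no ¬a) = away , ¬a
    missing (yes t) (yes a) = contradiction (t , a) (proj₂ (proj₂ (find found)))

  -- The list of edges of a walk may contain repetitions; the set `used` counts distinct edges, so
  -- that its size is bounded by the number of edges of the graph.
  record WalkIn (W : Subset order) (k : ℕ) : Set where
    constructor walkIn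
    field
      {base}    : Vertex
      walk      : Walk G base base
      confined  : ∀ {u} → u ∈ vertices G walk → u ∈ˢ W
      used      : Subset size
      used⊆     : ∀ {ε} → ε ∈ˢ used → ε ∈ edges G walk
      long      : k ℕ.≤ ∣ used ∣

  -- Some visited vertex lacks a direction among the arrows of the walk, but has it on an edge
  -- inside `W`. That edge is new, as its arrow would have counted otherwise, and its other end lies
  -- in `W` too.
  extend : ∀ {W} → Balanced W → ∀ {k} (r : WalkIn W k) → ¬ IsCycle G o (WalkIn.walk r) → WalkIn W (suc k)
  extend {W} balanced {k} (walkIn w confined used used⊆ long) ¬cycle =
    let u , u∈ , d , ¬d = missing-arrow w ¬cycle in
    insert u∈ ¬d (arrowIn-either d (balanced u (confined u∈)))
    where
    insert : ∀ {u d} → u ∈ vertices G w → ¬ HasArrow G o (edges G w) u d → ArrowIn W u d → WalkIn W (suc k)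
    insert u∈ ¬d (ε , h , inside , at-u , eq) = let w′ , old , new , visited = detour w u∈ ε h at-u in
      walkIn w′
        (λ x∈ → [ confined , (λ x≡ → subst (_∈ˢ W) (sym x≡) (inside (Fin.opposite h))) ]′ (visited x∈))
        (used ∪ ⁅ ε ⁆)
        (λ η∈ → [ (λ η∈used → old (used⊆ η∈used))
                , (λ η∈ε → subst (_∈ edges G w′) (sym (Subset.x∈⁅y⁆⇒x≡y ε η∈ε)) new) ]′
          (Subset.x∈p∪q⁻ used ⁅ ε ⁆ η∈))
        (ℕ.≤-trans (ℕ.s≤s long) (Subset.p⊂q⇒∣p∣<∣q∣
          ( Subset.p⊆p∪q ⁅ ε ⁆ , ε , Subset.q⊆p∪q used ⁅ ε ⁆ (Subset.x∈⁅x⁆ ε)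
          , λ ε∈used → ¬d (ε , h , used⊆ ε∈used , at-u , eq))))

  -- As long as a walk in a balanced set is not a cycle, a detour makes it use a new edge.
  long-walk : Acyclic G o → ∀ {W} → Balanced W → Nonempty W → ∀ k → WalkIn W k
  long-walk acyclic balanced (v , v∈W) zero    =
    walkIn {base = v} [] (λ { (here refl) → v∈W }) Subset.⊥ (λ ε∈ → contradiction ε∈ Subset.∉⊥) ℕ.z≤n
  long-walk acyclic balanced W≢∅       (suc k) =
    let r = long-walk acyclic balanced W≢∅ k in extend balanced r (acyclic (WalkIn.base r) (WalkIn.walk r))

  -- Without cycles, a balanced set would admit a walk with more distinct edges than the graph has.
  acyclic⇒acyclicOn : Acyclic G o → ∀ U → AcyclicOn U
  acyclic⇒acyclicOn acyclic U W _ W≢∅ balanced = ℕ.<⇒≱ (WalkIn.long r) (Subset.∣p∣≤n (WalkIn.used r))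
    where
    r = long-walk acyclic balanced W≢∅ (suc size)

  acyclic? : Dec (Acyclic G o)
  acyclic? = map′ acyclicOn-⊤⇒acyclic (λ acyclic → acyclic⇒acyclicOn acyclic ⊤) (acyclicOn? ⊤)

-- Strict colorings of an oriented graph

choices : List (Maybe Arrow)
choices = nothing ∷ just toward ∷ just away ∷ []

extreme : ℕ → Arrow → ℤ
extreme m toward = ℤ.+ suc m
extreme m away   = ℤ.-[1+ m ]

recolor : ℕ → Maybe Arrow → ℤ → ℤ
recolor m nothing  x = x
recolor m (just d) x = extreme m d

-- Keeps one copy of each recoloring that ignores the old color.
dummy : Maybe Arrow → ℤ → ℚ
dummy nothing  x = 1ℚ
dummy (just _) x = 𝟙 (x ℤ.≟ ℤ.+ 0)

∑-𝟙-zero : ∀ m k → ∑ (palette m) (λ x → 𝟙 (x ℤ.≟ ℤ.+ 0) * k) ≡ k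
∑-𝟙-zero m k = trans
  (zero-once m _ λ x x≢0 → trans (cong (_* k) (𝟙-no (x ℤ.≟ ℤ.+ 0) x≢0)) (ℚ.*-zeroˡ k))
  (ℚ.*-identityˡ k)

∑-palette-recolor : ∀ m (f : ℤ → ℚ) →
  ∑ (palette (suc m)) f ≡ ∑ choices (λ c → ∑ (palette m) (λ x → dummy c x * f (recolor m c x)))
∑-palette-recolor m f = begin
  ∑ (palette (suc m)) f
    ≡⟨ ∑-palette-suc m f ⟩
  f ℤ.-[1+ m ] + (∑ (palette m) f + f (ℤ.+ suc m))
    ≡⟨ solve 3 (λ x y z → x :+ (y :+ z) := y :+ (z :+ (x :+ con 0ℚ))) refl
         (f ℤ.-[1+ m ]) (∑ (palette m) f) (f (ℤ.+ suc m)) ⟩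
  ∑ (palette m) f + (f (ℤ.+ suc m) + (f ℤ.-[1+ m ] + 0ℚ))
    ≡⟨ cong₂ _+_ (∑-cong (palette m) λ x → ℚ.*-identityˡ (f x))
         (cong₂ _+_ (∑-𝟙-zero m (f (ℤ.+ suc m))) (cong (_+ 0ℚ) (∑-𝟙-zero m (f ℤ.-[1+ m ])))) ⟨
  ∑ choices (λ c → ∑ (palette m) (λ x → dummy c x * f (recolor m c x))) ∎

-- The summand of `c` is meant to run over colorings of the kept vertices. Letting every vertex
-- carry an old color, pinned to 0 where it is overwritten, keeps the same index set for all `c`.
∑-tuples-recolor : ∀ m n (F : Vec ℤ n → ℚ) →
  ∑ (tuples n (palette (suc m))) F ≡ ∑ (tuples n choices) (λ c → ∑ (tuples n (palette m)) (λ κ →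
    ∏ (λ v → dummy (lookup c v) (lookup κ v)) * F (Vec.zipWith (recolor m) c κ)))
∑-tuples-recolor m zero    F = solve 1 (λ x → x :+ con 0ℚ := con 1ℚ :* x :+ con 0ℚ :+ con 0ℚ) refl (F [])
∑-tuples-recolor m (suc n) F = begin
  ∑ (tuples (suc n) (palette (suc m))) F
    ≡⟨ ∑-tuples n (palette (suc m)) F ⟩
  ∑ (palette (suc m)) (λ a → ∑ (tuples n (palette (suc m))) (λ κ → F (a ∷ κ)))
    ≡⟨ ∑-cong (palette (suc m)) (λ a → ∑-tuples-recolor m n (λ κ → F (a ∷ κ))) ⟩
  ∑ (palette (suc m)) S
    ≡⟨ ∑-palette-recolor m S ⟩
  ∑ choices (λ b → ∑ (palette m) (λ x → dummy b x * S (recolor m b x)))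
    ≡⟨ ∑-cong choices (λ b → begin
      ∑ (palette m) (λ x → dummy b x * S (recolor m b x))
        ≡⟨ ∑-cong (palette m) (λ x → trans (sym (∑-*ˡ cs (dummy b x) _))
             (∑-cong cs λ c → sym (∑-*ˡ κs (dummy b x) _))) ⟩
      ∑ (palette m) (λ x → ∑ cs (λ c → ∑ κs (λ κ →
        dummy b x * (∏ (λ v → dummy (lookup c v) (lookup κ v)) * F (recolor m b x ∷ Vec.zipWith (recolor m) c κ)))))
        ≡⟨ ∑-swap (palette m) cs _ ⟩
      ∑ cs (λ c → ∑ (palette m) (λ x → ∑ κs (λ κ →
        dummy b x * (∏ (λ v → dummy (lookup c v) (lookup κ v)) * F (recolor m b x ∷ Vec.zipWith (recolor m) c κ)))))
        ≡⟨ ∑-cong cs (λ c → trans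
             (∑-cong (palette m) λ x → ∑-cong κs λ κ → sym (ℚ.*-assoc (dummy b x) _ _))
             (sym (∑-tuples n (palette m) _))) ⟩
      ∑ cs (λ c → ∑ (tuples (suc n) (palette m)) (λ κ →
        ∏ (λ v → dummy (lookup (b ∷ c) v) (lookup κ v)) * F (Vec.zipWith (recolor m) (b ∷ c) κ))) ∎) ⟩
  ∑ choices (λ b → ∑ cs (λ c → ∑ (tuples (suc n) (palette m)) (λ κ →
    ∏ (λ v → dummy (lookup (b ∷ c) v) (lookup κ v)) * F (Vec.zipWith (recolor m) (b ∷ c) κ))))
    ≡⟨ ∑-tuples n choices _ ⟨
  ∑ (tuples (suc n) choices) (λ c → ∑ (tuples (suc n) (palette m)) (λ κ →
    ∏ (λ v → dummy (lookup c v) (lookup κ v)) * F (Vec.zipWith (recolor m) c κ))) ∎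
  where
  cs = tuples n choices
  κs = tuples n (palette m)
  S : ℤ → ℚ
  S a = ∑ cs (λ c → ∑ κs (λ κ →
    ∏ (λ v → dummy (lookup c v) (lookup κ v)) * F (a ∷ Vec.zipWith (recolor m) c κ)))

∑-tuples-singleton : ∀ n (a : A) (F : Vec A n → ℚ) → ∑ (tuples n (a ∷ [])) F ≡ F (Vec.replicate n a)
∑-tuples-singleton zero    a F = ℚ.+-identityʳ (F [])
∑-tuples-singleton (suc n) a F = trans (∑-tuples n (a ∷ []) F) (trans
  (ℚ.+-identityʳ _) (∑-tuples-singleton n a (λ v → F (a ∷ v))))

-- The relation that an arrow imposes on the color of its vertex and on the signed
-- color of the other end.
Above : Arrow → ℤ → ℤ → Set
Above toward x y = y ℤ.< x
Above away   x y = x ℤ.< y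

above? : ∀ d x y → Dec (Above d x y)
above? toward x y = y ℤ.<? x
above? away   x y = x ℤ.<? y

above-irrefl : ∀ d x → ¬ Above d x x
above-irrefl toward x = ℤ.<-irrefl refl
above-irrefl away   x = ℤ.<-irrefl refl

above-extreme : ∀ {m} d y → ℤ.∣ y ∣ ℕ.≤ m → Above d (extreme m d) y
above-extreme toward = bounded⇒<
above-extreme away   = bounded⇒>

above-opposite-extreme : ∀ {m} d x → ℤ.∣ x ∣ ℕ.≤ m → Above d x (extreme m (opposite-arrow d))
above-opposite-extreme toward = bounded⇒>
above-opposite-extreme away   = bounded⇒<

above-extremes : ∀ m d → Above d (extreme m d) (extreme m (opposite-arrow d))
above-extremes m toward = ℤ.-<+
above-extremes m away   = ℤ.-<+

-- No color of the larger palette lies beyond an extreme one, so an extreme color dictates all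
-- arrows at its vertex.
above-extreme⁻ : ∀ {m} d′ d y → ℤ.∣ y ∣ ℕ.≤ suc m → Above d′ (extreme m d) y → d′ ≡ d
above-extreme⁻ toward toward y            _ _ = refl
above-extreme⁻ away   away   y            _ _ = refl
above-extreme⁻ away   toward (ℤ.+ n)      n≤ (ℤ.+<+ m<n) = contradiction n≤ (ℕ.<⇒≱ m<n)
above-extreme⁻ toward away   (ℤ.-[1+ k ]) k≤ (ℤ.-<- m<k) = contradiction k≤ (ℕ.<⇒≱ (ℕ.s≤s m<k))

compatible-sym : ∀ s {d d′} → Compatible s d d′ → Compatible s d′ d
compatible-sym Sign.+ = ≢-sym
compatible-sym Sign.- = sym

-- On a positive edge the arrows differ and the color is unchanged; on a negative edge they agree
-- and the color is negated. Either way this end sees the opposite extreme, by the symmetry of the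
-- palette.
signed-extreme : ∀ m s d d′ → Compatible s d d′ → (s ℤ.◃ 1) ℤ.* extreme m d′ ≡ extreme m (opposite-arrow d)
signed-extreme m Sign.+ toward toward d≢d′ = contradiction refl d≢d′
signed-extreme m Sign.+ toward away   _    = ℤ.*-identityˡ _
signed-extreme m Sign.+ away   toward _    = ℤ.*-identityˡ _
signed-extreme m Sign.+ away   away   d≢d′ = contradiction refl d≢d′
signed-extreme m Sign.- toward toward _    = ℤ.-1*i≡-i (ℤ.+ suc m)
signed-extreme m Sign.- away   away   _    = ℤ.-1*i≡-i ℤ.-[1+ m ]

∣signed∣ : ∀ s x → ℤ.∣ (s ℤ.◃ 1) ℤ.* x ∣ ≡ ℤ.∣ x ∣
∣signed∣ s x = trans (ℤ.abs-* (s ℤ.◃ 1) x)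
  (trans (cong (ℕ._* ℤ.∣ x ∣) (ℤ.abs-◃ s 1)) (ℕ.*-identityˡ ℤ.∣ x ∣))

recolor-bounded : ∀ {m} c x → ℤ.∣ x ∣ ℕ.≤ m → ℤ.∣ recolor m c x ∣ ℕ.≤ suc m
recolor-bounded nothing       x ∣x∣≤m = ℕ.m≤n⇒m≤1+n ∣x∣≤m
recolor-bounded (just toward) x _     = ℕ.≤-refl
recolor-bounded (just away)   x _     = ℕ.≤-refl

extreme≢0 : ∀ m d → extreme m d ≢ ℤ.+ 0
extreme≢0 m toward ()
extreme≢0 m away   ()

module Peeling (G : SignedGraph) (o : Arrows G) where
  open SignedGraph G
  open Acyclicity G o

  signed : Edge → ℤ → ℤ
  signed ε x = (sgn ε ℤ.◃ 1) ℤ.* x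

  StrictAt : (Vertex → ℤ) → Edge → Set
  StrictAt κ ε = ∀ h → Above (arrow G o ε h) (κ (endpoint ε h)) (signed ε (κ (endpoint ε (Fin.opposite h))))

  strictAt? : ∀ κ ε → Dec (StrictAt κ ε)
  strictAt? κ ε = Fin.all? λ h → above? (arrow G o ε h) _ _

  Strict : Subset order → (Vertex → ℤ) → Set
  Strict U κ = ∀ ε → Inside U ε → StrictAt κ ε

  strict? : ∀ U κ → Dec (Strict U κ)
  strict? U κ = Fin.all? λ ε → inside? U ε →-dec strictAt? κ ε

  strict-cong : ∀ {U κ κ′} → κ ≗ κ′ → Strict U κ → Strict U κ′
  strict-cong κ≗κ′ strict ε inside h = subst₂ (Above (arrow G o ε h))
    (κ≗κ′ _) (cong (signed ε) (κ≗κ′ _)) (strict ε inside h)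

  factor : (ℤ → ℚ) → Subset order → Vertex → ℤ → ℚ
  factor ξ U v x = if does (v Subset.∈? U) then ξ x else 𝟙 (x ℤ.≟ ℤ.+ 0)

  factor-in : ∀ ξ {U v} x → v ∈ˢ U → factor ξ U v x ≡ ξ x
  factor-in ξ {U} {v} x v∈U = if-yes (v Subset.∈? U) v∈U

  factor-out : ∀ ξ {U v} x → ¬ v ∈ˢ U → factor ξ U v x ≡ 𝟙 (x ℤ.≟ ℤ.+ 0)
  factor-out ξ {U} {v} x v∉U = if-no (v Subset.∈? U) v∉U

  -- The sum over the strict colorings of the subgraph induced by U with colors in
  -- -m , … , m; the vertices outside U get the dummy color 0.
  strictSum : (ℤ → ℚ) → ℕ → Subset order → ℚ
  strictSum ξ m U = ∑ (tuples order (palette m)) λ κ →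
    ∏ (λ v → factor ξ U v (lookup κ v)) * 𝟙 (strict? U (lookup κ))

  -- Vertices outside `U` meet no edge inside `U` and are vacuously uniform; the weight 0 prevents
  -- them from being peeled.
  weight : (Arrow → ℚ) → Subset order → Vertex → Maybe Arrow → ℚ
  weight w U v nothing  = 1ℚ
  weight w U v (just d) = if does (v Subset.∈? U) then w d else 0ℚ

  peelWeight : (Arrow → ℚ) → Subset order → Vec (Maybe Arrow) order → ℚ
  peelWeight w U c = ∏ λ v → weight w U v (lookup c v) * 𝟙 (peelableAt? U v (lookup c v))

  -- Removes from U a set of sinks of weight w toward and a set of sources of weight w away.
  peel : (Arrow → ℚ) → (Subset order → ℚ) → Subset order → ℚ
  peel w g U = ∑ (tuples order choices) λ c → peelWeight w U c * g (U ∩ kept c)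

  peel-cong : ∀ w {g g′} → (∀ U → g U ≡ g′ U) → ∀ U → peel w g U ≡ peel w g′ U
  peel-cong w g≡g′ U = ∑-cong (tuples order choices) λ c → cong (peelWeight w U c *_) (g≡g′ (U ∩ kept c))

  peelWeight-split : ∀ w U c → peelWeight w U c ≡ ∏ (λ v → weight w U v (lookup c v)) * 𝟙 (peelable? U c)
  peelWeight-split w U c = trans
    (∏-distrib-* (λ v → weight w U v (lookup c v)) (λ v → 𝟙 (peelableAt? U v (lookup c v))))
    (cong (∏ (λ v → weight w U v (lookup c v)) *_)
      (sym (𝟙-all (λ v → peelableAt? U v (lookup c v)) (peelable? U c))))

  module _ (oriented : IsOrientation G o) where

    compatible : ∀ ε h → Compatible (sgn ε) (arrow G o ε h) (arrow G o ε (Fin.opposite h))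
    compatible ε zero       = oriented ε
    compatible ε (suc zero) = compatible-sym (sgn ε) (oriented ε)

    module _ {m} (U : Subset order) (c : Vec (Maybe Arrow) order) (κ : Vertex → ℤ)
             (bounded : ∀ v → ℤ.∣ κ v ∣ ℕ.≤ m) where

      recolored : Vertex → ℤ
      recolored v = recolor m (lookup c v) (κ v)

      -- A vertex with an extreme color is a sink or source of `U` by `above-extreme⁻`; edges
      -- between kept vertices have their old colors.
      strict-recolored⁻ : Strict U recolored → Peelable U c × Strict (U ∩ kept c) κ
      strict-recolored⁻ strict = (λ v → uniform v (lookup c v) refl) , strict-kept
        where
        uniform : ∀ v x → lookup c v ≡ x → PeelableAt U v x
        uniform v nothing  _   = tt
        uniform v (just d) c≡ ε h inside refl = above-extreme⁻ {m} (arrow G o ε h) d _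
          (subst (ℕ._≤ suc m) (sym (∣signed∣ (sgn ε) _))
            (recolor-bounded (lookup c (endpoint ε (Fin.opposite h))) _ (bounded _)))
          (subst (λ x → Above (arrow G o ε h) (recolor m x (κ v)) (signed ε (recolored (endpoint ε (Fin.opposite h)))))
            c≡ (strict ε inside h))
        strict-kept : Strict (U ∩ kept c) κ
        strict-kept ε inside h = subst₂ (λ x y → Above (arrow G o ε h)
            (recolor m x (κ (endpoint ε h))) (signed ε (recolor m y (κ (endpoint ε (Fin.opposite h))))))
          (stays h) (stays (Fin.opposite h))
          (strict ε (λ h′ → Subset.p∩q⊆p U (kept c) (inside h′)) h)
          where
          stays : ∀ h′ → lookup c (endpoint ε h′) ≡ nothing
          stays h′ = ∈-kept⁻ c (Subset.p∩q⊆q U (kept c) (inside h′))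

      -- An extreme color at one end beats every old color at the other end, and two extreme colors
      -- on an edge meet as opposite extremes by `signed-extreme`.
      strict-recolored⁺ : Peelable U c → Strict (U ∩ kept c) κ → Strict U recolored
      strict-recolored⁺ peelable strict ε inside h =
        cases (lookup c u) (lookup c u′) refl refl (peelable u) (peelable u′)
        where
        h′ = Fin.opposite h
        u  = endpoint ε h
        u′ = endpoint ε h′
        opposite-extreme : ∀ {d} → arrow G o ε h′ ≡ d →
          extreme m (opposite-arrow (arrow G o ε h)) ≡ signed ε (extreme m d)
        opposite-extreme refl = sym (signed-extreme m (sgn ε) _ _ (compatible ε h))
        cases : ∀ x x′ → lookup c u ≡ x → lookup c u′ ≡ x′ → PeelableAt U u x → PeelableAt U u′ x′ →
                Above (arrow G o ε h) (recolor m x (κ u)) (signed ε (recolor m x′ (κ u′)))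
        cases nothing nothing c≡ c′≡ _ _ = strict ε
          (λ h″ → Subset.x∈p∩q⁺ (inside h″ , ∈-kept⁺ c
            ([ (λ h″≡ → trans (cong (lookup c ∘ endpoint ε) h″≡) c≡)
             , (λ h″≡ → trans (cong (lookup c ∘ endpoint ε) h″≡) c′≡) ]′ (half-edges h h″)))) h
        cases (just d) nothing _ _ uniform _ =
          subst (λ d → Above (arrow G o ε h) (extreme m d) (signed ε (κ u′))) (uniform ε h inside refl)
            (above-extreme (arrow G o ε h) _ (subst (ℕ._≤ m) (sym (∣signed∣ (sgn ε) _)) (bounded u′)))
        cases nothing (just d) _ _ _ uniform =
          subst (Above (arrow G o ε h) (κ u)) (opposite-extreme (uniform ε h′ inside refl))
            (above-opposite-extreme (arrow G o ε h) (κ u) (bounded u))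
        cases (just d) (just d′) _ _ uniform uniform′ =
          subst₂ (λ d → Above (arrow G o ε h) (extreme m d))
            (uniform ε h inside refl) (opposite-extreme (uniform′ ε h′ inside refl))
            (above-extremes m (arrow G o ε h))

    -- Expansion by the set of vertices with extreme colors. For each choice `c` the weights are
    -- compared vertex by vertex and the conditions by the two lemmas on recolored maps.
    strictSum-suc : ∀ ξ w m → (∀ d → ξ (extreme m d) ≡ w d) → (∀ x → ℤ.∣ x ∣ ℕ.≤ m → ξ x ≡ - 1ℚ) →
      ∀ U → strictSum ξ (suc m) U ≡ peel w (strictSum (λ _ → - 1ℚ) m) U
    strictSum-suc ξ w m ξ-extreme ξ-middle U = trans
      (∑-tuples-recolor m order _)
      (∑-cong (tuples order choices) λ c → trans
        (∑-tuples-cong (palette-bounded m) (term c))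
        (∑-*ˡ (tuples order (palette m)) (peelWeight w U c) _))
      where
      term : ∀ c κ → (∀ v → ℤ.∣ lookup κ v ∣ ℕ.≤ m) →
        ∏ (λ v → dummy (lookup c v) (lookup κ v)) *
          (∏ (λ v → factor ξ U v (lookup (Vec.zipWith (recolor m) c κ) v))
            * 𝟙 (strict? U (lookup (Vec.zipWith (recolor m) c κ))))
        ≡ peelWeight w U c * (∏ (λ v → factor (λ _ → - 1ℚ) (U ∩ kept c) v (lookup κ v))
            * 𝟙 (strict? (U ∩ kept c) (lookup κ)))
      term c κ bounded = begin
        ∏ δ * (∏ f * 𝟙 (strict? U (lookup κ′)))
          ≡⟨ ℚ.*-assoc (∏ δ) (∏ f) _ ⟨
        (∏ δ * ∏ f) * 𝟙 (strict? U (lookup κ′))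
          ≡⟨ cong₂ _*_ (trans (sym (∏-distrib-* δ f)) (trans (∏-cong vertex) (∏-distrib-* ω f′))) strictness ⟩
        (∏ ω * ∏ f′) * (𝟙 (peelable? U c) * 𝟙 (strict? (U ∩ kept c) (lookup κ)))
          ≡⟨ solve 4 (λ a b c d → (a :* b) :* (c :* d) := (a :* c) :* (b :* d)) refl
               (∏ ω) (∏ f′) (𝟙 (peelable? U c)) (𝟙 (strict? (U ∩ kept c) (lookup κ))) ⟩
        (∏ ω * 𝟙 (peelable? U c)) * (∏ f′ * 𝟙 (strict? (U ∩ kept c) (lookup κ)))
          ≡⟨ cong (_* (∏ f′ * 𝟙 (strict? (U ∩ kept c) (lookup κ)))) (peelWeight-split w U c) ⟨
        peelWeight w U c * (∏ f′ * 𝟙 (strict? (U ∩ kept c) (lookup κ))) ∎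
        where
        κ′ = Vec.zipWith (recolor m) c κ
        δ f ω f′ : Vertex → ℚ
        δ v  = dummy (lookup c v) (lookup κ v)
        f v  = factor ξ U v (lookup κ′ v)
        ω v  = weight w U v (lookup c v)
        f′ v = factor (λ _ → - 1ℚ) (U ∩ kept c) v (lookup κ v)
        κ′≗ : ∀ v → lookup κ′ v ≡ recolor m (lookup c v) (lookup κ v)
        κ′≗ v = Vec.lookup-zipWith (recolor m) v c κ
        strictness : 𝟙 (strict? U (lookup κ′)) ≡ 𝟙 (peelable? U c) * 𝟙 (strict? (U ∩ kept c) (lookup κ))
        strictness = trans
          (𝟙-⇔ (strict? U (lookup κ′)) (peelable? U c ×-dec strict? (U ∩ kept c) (lookup κ))
            (λ strict → strict-recolored⁻ U c (lookup κ) bounded (strict-cong κ′≗ strict))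
            (λ (peelable , strict) → strict-cong (sym ∘ κ′≗) (strict-recolored⁺ U c (lookup κ) bounded peelable strict)))
          (𝟙-× (peelable? U c) (strict? (U ∩ kept c) (lookup κ)))
        vertex : ∀ v → δ v * f v ≡ ω v * f′ v
        vertex v = trans (cong (λ x → δ v * factor ξ U v x) (κ′≗ v))
          (cases (lookup c v) refl (v Subset.∈? U))
          where
          x = lookup κ v
          cases : ∀ y → lookup c v ≡ y → Dec (v ∈ˢ U) →
            dummy y x * factor ξ U v (recolor m y x) ≡ weight w U v y * f′ v
          cases nothing c≡ (yes v∈U) = cong (1ℚ *_) (begin
            factor ξ U v x   ≡⟨ factor-in ξ x v∈U ⟩
            ξ x              ≡⟨ ξ-middle x (bounded v) ⟩
            - 1ℚ             ≡⟨ factor-in _ x (Subset.x∈p∩q⁺ (v∈U , ∈-kept⁺ c c≡)) ⟨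
            f′ v             ∎)
          cases nothing c≡ (no v∉U) = cong (1ℚ *_) (trans (factor-out ξ x v∉U)
            (sym (factor-out _ x (v∉U ∘ Subset.p∩q⊆p U (kept c)))))
          cases (just d) c≡ (yes v∈U) = begin
            𝟙 (x ℤ.≟ ℤ.+ 0) * factor ξ U v (extreme m d)
              ≡⟨ cong (𝟙 (x ℤ.≟ ℤ.+ 0) *_) (trans (factor-in ξ _ v∈U) (ξ-extreme d)) ⟩
            𝟙 (x ℤ.≟ ℤ.+ 0) * w d
              ≡⟨ ℚ.*-comm (𝟙 (x ℤ.≟ ℤ.+ 0)) (w d) ⟩
            w d * 𝟙 (x ℤ.≟ ℤ.+ 0)
              ≡⟨ cong₂ _*_ (if-yes (v Subset.∈? U) v∈U) (factor-out _ x removed) ⟨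
            weight w U v (just d) * f′ v ∎
            where
            removed : ¬ v ∈ˢ U ∩ kept c
            removed v∈ with () ← trans (sym c≡) (∈-kept⁻ c (Subset.p∩q⊆q U (kept c) v∈))
          -- Outside `U` only the dummy color 0 counts, and an extreme color is not 0.
          cases (just d) c≡ (no v∉U) = begin
            𝟙 (x ℤ.≟ ℤ.+ 0) * factor ξ U v (extreme m d)
              ≡⟨ cong (𝟙 (x ℤ.≟ ℤ.+ 0) *_) (trans (factor-out ξ _ v∉U) (𝟙-no (extreme m d ℤ.≟ ℤ.+ 0) (extreme≢0 m d))) ⟩
            𝟙 (x ℤ.≟ ℤ.+ 0) * 0ℚ
              ≡⟨ trans (ℚ.*-zeroʳ (𝟙 (x ℤ.≟ ℤ.+ 0))) (sym (ℚ.*-zeroˡ (f′ v))) ⟩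
            0ℚ * f′ v
              ≡⟨ cong (_* f′ v) (if-no (v Subset.∈? U) v∉U) ⟨
            weight w U v (just d) * f′ v ∎

-- Reciprocity

lookup-injective : ∀ {n} (v w : Vec A n) → lookup v ≗ lookup w → v ≡ w
lookup-injective v w eq = trans (sym (Vec.tabulate∘lookup v)) (trans (Vec.tabulate-cong eq) (Vec.tabulate∘lookup w))

infix 4 _≟ᶜ_
_≟ᶜ_ : ∀ {n} → DecidableEquality (Vec (Maybe Arrow) n)
_≟ᶜ_ = Vec.≡-dec (Maybe.≡-dec _≟ᵃ_)

choices-unique : Unique choices
choices-unique = ((λ ()) ∷ (λ ()) ∷ []) ∷ ((λ ()) ∷ []) ∷ [] ∷ []

∈-choices : ∀ x → x ∈ choices
∈-choices nothing       = here refl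
∈-choices (just toward) = there (here refl)
∈-choices (just away)   = there (there (here refl))

-- The extrapolation to m = -1 of the signed number of strict colorings with colors in
-- -m , … , m, as a function of the subset U of vertices to be colored and of m + 1.
module Reciprocity (G : SignedGraph) (o : Arrows G) where
  open SignedGraph G
  open Acyclicity G o
  open Peeling G o

  minusOne : Arrow → ℚ
  minusOne _ = - 1ℚ

  extrapolated : ℕ → Subset order → ℚ
  extrapolated zero    U = 𝟙 (acyclicOn? U)
  extrapolated (suc j) U = peel minusOne (extrapolated j) U

  vertexSum : (Arrow → ℚ) → Subset order → Vertex → ℚ
  vertexSum w U v = ∑ choices λ x → weight w U v x * 𝟙 (peelableAt? U v x)

  vertexSum-in : ∀ w U v → v ∈ˢ U → vertexSum w U v ≡
    1ℚ + (w toward * 𝟙 (uniform? U v toward) + w away * 𝟙 (uniform? U v away))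
  vertexSum-in w U v v∈U = trans
    (cong₂ (λ a b → 1ℚ * 1ℚ + (a * 𝟙 (uniform? U v toward) + (b * 𝟙 (uniform? U v away) + 0ℚ)))
      (if-yes (v Subset.∈? U) v∈U) (if-yes (v Subset.∈? U) v∈U))
    (solve 2 (λ a b → con 1ℚ :* con 1ℚ :+ (a :+ (b :+ con 0ℚ)) := con 1ℚ :+ (a :+ b)) refl
      (w toward * 𝟙 (uniform? U v toward)) (w away * 𝟙 (uniform? U v away)))

  vertexSum-out : ∀ w U v → ¬ v ∈ˢ U → vertexSum w U v ≡ 1ℚ
  vertexSum-out w U v v∉U = trans
    (cong₂ (λ a b → 1ℚ * 1ℚ + (a * 𝟙 (uniform? U v toward) + (b * 𝟙 (uniform? U v away) + 0ℚ)))
      (if-no (v Subset.∈? U) v∉U) (if-no (v Subset.∈? U) v∉U))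
    (solve 2 (λ a b → con 1ℚ :* con 1ℚ :+ (con 0ℚ :* a :+ (con 0ℚ :* b :+ con 0ℚ)) := con 1ℚ) refl
      (𝟙 (uniform? U v toward)) (𝟙 (uniform? U v away)))

  -- Peeling does not affect acyclicity, so the indicator leaves the sum, and what remains factors
  -- over the vertices.
  peel-acyclic : ∀ w U → peel w (λ U → 𝟙 (acyclicOn? U)) U ≡ 𝟙 (acyclicOn? U) * ∏ (vertexSum w U)
  peel-acyclic w U = begin
    ∑ cs (λ c → peelWeight w U c * 𝟙 (acyclicOn? (U ∩ kept c)))
      ≡⟨ ∑-cong cs (λ c → begin
           peelWeight w U c * 𝟙 (acyclicOn? (U ∩ kept c))
             ≡⟨ cong (_* 𝟙 (acyclicOn? (U ∩ kept c))) (peelWeight-split w U c) ⟩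
           W c * 𝟙 (peelable? U c) * 𝟙 (acyclicOn? (U ∩ kept c))
             ≡⟨ ℚ.*-assoc (W c) (𝟙 (peelable? U c)) _ ⟩
           W c * (𝟙 (peelable? U c) * 𝟙 (acyclicOn? (U ∩ kept c)))
             ≡⟨ cong (W c *_) (𝟙-cong-* (peelable? U c) λ peelable →
                  𝟙-⇔ (acyclicOn? (U ∩ kept c)) (acyclicOn? U)
                    (acyclicOn-peel⁺ U c peelable) (acyclicOn-peel⁻ U c)) ⟩
           W c * (𝟙 (peelable? U c) * 𝟙 (acyclicOn? U))
             ≡⟨ ℚ.*-assoc (W c) (𝟙 (peelable? U c)) _ ⟨
           W c * 𝟙 (peelable? U c) * 𝟙 (acyclicOn? U)
             ≡⟨ cong (_* 𝟙 (acyclicOn? U)) (peelWeight-split w U c) ⟨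
           peelWeight w U c * 𝟙 (acyclicOn? U) ∎) ⟩
    ∑ cs (λ c → peelWeight w U c * 𝟙 (acyclicOn? U))
      ≡⟨ ∑-*ʳ cs (𝟙 (acyclicOn? U)) (peelWeight w U) ⟩
    ∑ cs (peelWeight w U) * 𝟙 (acyclicOn? U)
      ≡⟨ cong (_* 𝟙 (acyclicOn? U)) (∑-tuples-∏ choices λ v x → weight w U v x * 𝟙 (peelableAt? U v x)) ⟩
    ∏ (vertexSum w U) * 𝟙 (acyclicOn? U)
      ≡⟨ ℚ.*-comm (∏ (vertexSum w U)) (𝟙 (acyclicOn? U)) ⟩
    𝟙 (acyclicOn? U) * ∏ (vertexSum w U) ∎
    where
    cs = tuples order choices
    W : Vec (Maybe Arrow) order → ℚ
    W c = ∏ λ v → weight w U v (lookup c v)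

  edgeIn? : ∀ U → Dec (∃[ ε ] Inside U ε)
  edgeIn? U = Fin.any? (inside? U)

  -- Uniform in exactly one direction: a sink or a source, but not isolated.
  OneWay : Subset order → Vertex → Set
  OneWay U v = (Uniform U v toward × ¬ Uniform U v away) ⊎ (Uniform U v away × ¬ Uniform U v toward)

  oneWay? : ∀ U v → Dec (OneWay U v)
  oneWay? U v = (uniform? U v toward ×-dec ¬? (uniform? U v away))
    ⊎-dec (uniform? U v away ×-dec ¬? (uniform? U v toward))

  -- Otherwise the vertices that are not isolated form a balanced set.
  acyclicOn⇒oneWay : ∀ U → AcyclicOn U → ∃[ ε ] Inside U ε → ∃[ v ] v ∈ˢ U × OneWay U v
  acyclicOn⇒oneWay U acyclic (ε₀ , inside₀) with Fin.any? (λ v → v Subset.∈? U ×-dec oneWay? U v)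
  ... | yes found  = found
  ... | no  ¬found = contradiction balanced
    (acyclic W (proj₁ ∘ ∈-select⁻ member?) (endpoint ε₀ zero , edge-in-W ε₀ inside₀ zero))
    where
    member? : Decidable (λ v → v ∈ˢ U × ¬ Uniform U v toward)
    member? v = v Subset.∈? U ×-dec ¬? (uniform? U v toward)
    W = select member?
    away⇒toward : ∀ {v} → v ∈ˢ U → Uniform U v away → Uniform U v toward
    away⇒toward {v} v∈U a with uniform? U v toward
    ... | yes t = t
    ... | no ¬t = contradiction (v , v∈U , inj₂ (a , ¬t)) ¬found
    toward⇒away : ∀ {v} → v ∈ˢ U → Uniform U v toward → Uniform U v away
    toward⇒away {v} v∈U t with uniform? U v away
    ... | yes a = a
    ... | no ¬a = contradiction (v , v∈U , inj₁ (t , ¬a)) ¬found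
    -- An end that is a sink would be a source too, and the arrow of this edge would have both
    -- directions.
    edge-in-W : ∀ ε → Inside U ε → Inside W ε
    edge-in-W ε inside h = ∈-select⁺ member? (inside h , λ t →
      contradiction (trans (sym (t ε h inside refl)) (toward⇒away (inside h) t ε h inside refl)) λ ())
    arrow-in-W : ∀ {v d} → ArrowIn U v d → ArrowIn W v d
    arrow-in-W (ε , h , inside , at-v , eq) = ε , h , edge-in-W ε inside , at-v , eq
    balanced : Balanced W
    balanced v v∈W = let v∈U , ¬t = ∈-select⁻ member? v∈W in
      arrow-in-W (¬uniform⇒arrowIn (¬t ∘ away⇒toward v∈U)) , arrow-in-W (¬uniform⇒arrowIn ¬t)

  -- Keeping the vertex contributes 1, peeling it in its only direction contributes -1.
  vertexSum-oneWay : ∀ U v → v ∈ˢ U → OneWay U v → vertexSum minusOne U v ≡ 0ℚ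
  vertexSum-oneWay U v v∈U (inj₁ (t , ¬a)) = trans (vertexSum-in minusOne U v v∈U)
    (cong₂ (λ x y → 1ℚ + (- 1ℚ * x + - 1ℚ * y)) (𝟙-yes (uniform? U v toward) t) (𝟙-no (uniform? U v away) ¬a))
  vertexSum-oneWay U v v∈U (inj₂ (a , ¬t)) = trans (vertexSum-in minusOne U v v∈U)
    (cong₂ (λ x y → 1ℚ + (- 1ℚ * x + - 1ℚ * y)) (𝟙-no (uniform? U v toward) ¬t) (𝟙-yes (uniform? U v away) a))

  -- With 0 as the only color no edge can be strict. So if `U` contains an edge, the left side is 0,
  -- and so is the right: either `U` is not acyclic or a one-way vertex gives a factor 0. Without
  -- edges each vertex of `U` contributes -1 on the left and `1 - 1 - 1` on the right.
  strictSum-zero : ∀ U → strictSum (λ _ → - 1ℚ) 0 U ≡ extrapolated 1 U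
  strictSum-zero U = trans (∑-tuples-singleton order (ℤ.+ 0) _)
    (trans (cases (edgeIn? U)) (sym (peel-acyclic minusOne U)))
    where
    zeros = Vec.replicate order (ℤ.+ 0)
    f : Vertex → ℚ
    f v = factor (λ _ → - 1ℚ) U v (lookup zeros v)
    all-zero : ∀ v → lookup zeros v ≡ ℤ.+ 0
    all-zero v = Vec.lookup-replicate v (ℤ.+ 0)
    not-strict : ∀ ε → ¬ StrictAt (lookup zeros) ε
    not-strict ε strict = above-irrefl (arrow G o ε zero) (ℤ.+ 0)
      (subst₂ (Above (arrow G o ε zero)) (all-zero _)
        (trans (cong (signed ε) (all-zero _)) (ℤ.*-zeroʳ (sgn ε ℤ.◃ 1))) (strict zero))
    cases : Dec (∃[ ε ] Inside U ε) →
      ∏ f * 𝟙 (strict? U (lookup zeros)) ≡ 𝟙 (acyclicOn? U) * ∏ (vertexSum minusOne U)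
    cases (yes edge@(ε , inside)) = trans
      (cong (∏ f *_) (𝟙-no (strict? U (lookup zeros)) λ strict → not-strict ε (strict ε inside)))
      (trans (ℚ.*-zeroʳ (∏ f)) (sym (trans
        (𝟙-cong-* (acyclicOn? U) λ acyclic → let v , v∈U , oneWay = acyclicOn⇒oneWay U acyclic edge in
          ∏-zero (vertexSum minusOne U) v (vertexSum-oneWay U v v∈U oneWay))
        (ℚ.*-zeroʳ (𝟙 (acyclicOn? U))))))
    cases (no ¬edge) = begin
      ∏ f * 𝟙 (strict? U (lookup zeros))
        ≡⟨ cong (∏ f *_) (𝟙-yes (strict? U (lookup zeros)) λ ε inside → contradiction (ε , inside) ¬edge) ⟩
      ∏ f * 1ℚ
        ≡⟨ ℚ.*-comm (∏ f) 1ℚ ⟩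
      1ℚ * ∏ f
        ≡⟨ cong₂ _*_ (sym (𝟙-yes (acyclicOn? U) acyclic)) (∏-cong λ v → vertex v (v Subset.∈? U)) ⟩
      𝟙 (acyclicOn? U) * ∏ (vertexSum minusOne U) ∎
      where
      acyclic : AcyclicOn U
      acyclic W W⊆U (v , v∈W) balanced = let ε , _ , inside , _ = proj₁ (balanced v v∈W) in
        ¬edge (ε , λ h → W⊆U (inside h))
      uniform : ∀ v d → Uniform U v d
      uniform v d ε h inside = contradiction (ε , inside) ¬edge
      vertex : ∀ v → Dec (v ∈ˢ U) → f v ≡ vertexSum minusOne U v
      vertex v (yes v∈U) = trans (factor-in (λ _ → - 1ℚ) (lookup zeros v) v∈U) (sym (trans (vertexSum-in minusOne U v v∈U)
        (cong₂ (λ x y → 1ℚ + (- 1ℚ * x + - 1ℚ * y))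
          (𝟙-yes (uniform? U v toward) (uniform v toward)) (𝟙-yes (uniform? U v away) (uniform v away)))))
      vertex v (no v∉U) = trans (factor-out (λ _ → - 1ℚ) (lookup zeros v) v∉U) (trans
        (𝟙-yes (lookup zeros v ℤ.≟ ℤ.+ 0) (all-zero v)) (sym (vertexSum-out minusOne U v v∉U)))

  strictSum≡extrapolated : IsOrientation G o → ∀ m U → strictSum (λ _ → - 1ℚ) m U ≡ extrapolated (suc m) U
  strictSum≡extrapolated oriented zero    U = strictSum-zero U
  strictSum≡extrapolated oriented (suc m) U = trans
    (strictSum-suc oriented (λ _ → - 1ℚ) minusOne m (λ _ → refl) (λ _ _ → refl) U)
    (peel-cong minusOne (strictSum≡extrapolated oriented m) U)

  -- Induction on a bound for the size of `U`. Taking the difference in `j` cancels the trivial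
  -- peeling `none`; every other peeling of nonzero weight leaves a proper subset of `U`.
  polynomial-extrapolated : ∀ k U → ∣ U ∣ ℕ.< k → IsPolynomial (λ j → extrapolated j U)
  polynomial-extrapolated (suc k) U (ℕ.s≤s ∣U∣≤k) = polynomial-from-Δ (polynomial-cong (sym ∘ Δ≡)
    (polynomial-∑ cs λ c → term c (Fin.any? λ v → v Subset.∈? U ×-dec ¬? (Maybe.≡-dec _≟ᵃ_ (lookup c v) nothing))))
    where
    cs = tuples order choices
    none = Vec.replicate order nothing
    ω : Vec (Maybe Arrow) order → ℚ
    ω = peelWeight minusOne U
    lookup-none : ∀ v → lookup none v ≡ nothing
    lookup-none v = Vec.lookup-replicate v nothing
    ω-none : ω none ≡ 1ℚ
    ω-none = ∏-one _ λ v → cong (λ x → weight minusOne U v x * 𝟙 (peelableAt? U v x)) (lookup-none v)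
    kept-none : U ∩ kept none ≡ U
    kept-none = trans (cong (U ∩_) (Vec.map-replicate is-nothing nothing order)) (Subset.∩-identityʳ U)
    once-none : Once none cs
    once-none = once-tuples none λ v → unique⇒once choices-unique (∈-choices (lookup none v))
    coefficient : Vec (Maybe Arrow) order → ℚ
    coefficient c = (1ℚ - 𝟙 (c ≟ᶜ none)) * ω c
    Δ≡ : ∀ j → extrapolated (suc j) U - extrapolated j U ≡ ∑ cs (λ c → coefficient c * extrapolated j (U ∩ kept c))
    Δ≡ j = begin
      ∑ cs (λ c → ω c * g c) - extrapolated j U
        ≡⟨ solve 2 (λ x y → x :- y := x :+ con (- 1ℚ) :* y) refl (∑ cs (λ c → ω c * g c)) (extrapolated j U) ⟩
      ∑ cs (λ c → ω c * g c) + - 1ℚ * extrapolated j U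
        ≡⟨ cong (∑ cs (λ c → ω c * g c) +_) (cong (- 1ℚ *_) at-none) ⟩
      ∑ cs (λ c → ω c * g c) + - 1ℚ * ∑ cs (λ c → 𝟙 (c ≟ᶜ none) * (ω c * g c))
        ≡⟨ cong (∑ cs (λ c → ω c * g c) +_) (∑-*ˡ cs (- 1ℚ) _) ⟨
      ∑ cs (λ c → ω c * g c) + ∑ cs (λ c → - 1ℚ * (𝟙 (c ≟ᶜ none) * (ω c * g c)))
        ≡⟨ ∑-+ cs _ _ ⟨
      ∑ cs (λ c → ω c * g c + - 1ℚ * (𝟙 (c ≟ᶜ none) * (ω c * g c)))
        ≡⟨ ∑-cong cs (λ c → solve 3 (λ i w x → w :* x :+ con (- 1ℚ) :* (i :* (w :* x)) := (con 1ℚ :- i) :* w :* x) refl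
             (𝟙 (c ≟ᶜ none)) (ω c) (g c)) ⟩
      ∑ cs (λ c → coefficient c * g c) ∎
      where
      g : Vec (Maybe Arrow) order → ℚ
      g c = extrapolated j (U ∩ kept c)
      at-none : extrapolated j U ≡ ∑ cs (λ c → 𝟙 (c ≟ᶜ none) * (ω c * g c))
      at-none = sym (begin
        ∑ cs (λ c → 𝟙 (c ≟ᶜ none) * (ω c * g c))
          ≡⟨ once-none _ (λ c c≢ → trans (cong (_* (ω c * g c)) (𝟙-no (c ≟ᶜ none) c≢)) (ℚ.*-zeroˡ (ω c * g c))) ⟩
        𝟙 (none ≟ᶜ none) * (ω none * g none)
          ≡⟨ cong₂ _*_ (𝟙-yes (none ≟ᶜ none) refl) (cong₂ _*_ ω-none (cong (extrapolated j) kept-none)) ⟩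
        1ℚ * (1ℚ * extrapolated j U)
          ≡⟨ trans (ℚ.*-identityˡ _) (ℚ.*-identityˡ _) ⟩
        extrapolated j U ∎)
    -- Such a `c` is either `none`, removed by the first factor, or it peels a vertex outside `U`,
    -- of weight 0.
    coefficient≡0 : ∀ c → (∀ v → v ∈ˢ U → lookup c v ≡ nothing) → coefficient c ≡ 0ℚ
    coefficient≡0 c stays with c ≟ᶜ none | Fin.any? (λ v → ¬? (Maybe.≡-dec _≟ᵃ_ (lookup c v) nothing))
    ... | yes _     | _             = ℚ.*-zeroˡ (ω c)
    ... | no c≢none | yes (v , cv≢) = trans (cong ((1ℚ - 0ℚ) *_) (∏-zero _ v (outside (lookup c v) cv≢)))
                                        (ℚ.*-zeroʳ (1ℚ - 0ℚ))
      where
      outside : ∀ x → x ≢ nothing → weight minusOne U v x * 𝟙 (peelableAt? U v x) ≡ 0ℚ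
      outside nothing  x≢ = contradiction refl x≢
      outside (just d) _  = trans
        (cong (_* 𝟙 (uniform? U v d)) (if-no (v Subset.∈? U) λ v∈U → cv≢ (stays v v∈U)))
        (ℚ.*-zeroˡ (𝟙 (uniform? U v d)))
    ... | no c≢none | no ¬any = contradiction (lookup-injective c none λ v → trans (stay v) (sym (lookup-none v))) c≢none
      where
      stay : ∀ v → lookup c v ≡ nothing
      stay v with Maybe.≡-dec _≟ᵃ_ (lookup c v) nothing
      ... | yes eq = eq
      ... | no neq = contradiction (v , neq) ¬any
    term : ∀ c → Dec (∃[ v ] v ∈ˢ U × lookup c v ≢ nothing) →
           IsPolynomial (λ j → coefficient c * extrapolated j (U ∩ kept c))
    term c (yes (v , v∈U , cv≢)) = polynomial-* (polynomial-const (coefficient c))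
      (polynomial-extrapolated k (U ∩ kept c) (ℕ.<-≤-trans
        (Subset.p⊂q⇒∣p∣<∣q∣ ( Subset.p∩q⊆p U (kept c) , v , v∈U
                            , λ v∈ → cv≢ (∈-kept⁻ c (Subset.p∩q⊆q U (kept c) v∈))))
        ∣U∣≤k))
    term c (no ¬any) = polynomial-cong
      (λ j → sym (trans (cong (_* extrapolated j (U ∩ kept c)) (coefficient≡0 c stays)) (ℚ.*-zeroˡ (extrapolated j (U ∩ kept c)))))
      (polynomial-const 0ℚ)
      where
      stays : ∀ v → v ∈ˢ U → lookup c v ≡ nothing
      stays v v∈U with Maybe.≡-dec _≟ᵃ_ (lookup c v) nothing
      ... | yes eq = eq
      ... | no neq = contradiction (v , v∈U , neq) ¬any

  -- A sink may be given the top color, of weight t - 1; the bottom color has weight 0.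
  topWeight : ℚ → Arrow → ℚ
  topWeight t toward = t - 1ℚ
  topWeight t away   = 0ℚ

  -- Only the outermost peeling, that of the colors `m + 1` and `-m-1`, carries the special weights;
  -- all further colors weigh -1.
  sinkPolynomial : ℚ → ℕ → ℚ
  sinkPolynomial t j = peel (topWeight t) (extrapolated j) ⊤

  polynomial-sinkPolynomial : ∀ t → IsPolynomial (sinkPolynomial t)
  polynomial-sinkPolynomial t = polynomial-∑ (tuples order choices) λ c →
    polynomial-* (polynomial-const (peelWeight (topWeight t) ⊤ c))
      (polynomial-extrapolated (suc ∣ ⊤ ∩ kept c ∣) (⊤ ∩ kept c) ℕ.≤-refl)

  -- Factored over the vertices, a sink contributes `1 + (t - 1) = t` and any other vertex 1, as
  -- sources have weight 0. An isolated vertex gives `t` as well, in accordance with `Sink`.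
  sinkPolynomial-0 : ∀ t → sinkPolynomial t 0 ≡ 𝟙 acyclic? * t ^ sinks G o
  sinkPolynomial-0 t = trans (peel-acyclic (topWeight t) ⊤) (cong₂ _*_
    (𝟙-⇔ (acyclicOn? ⊤) acyclic? acyclicOn-⊤⇒acyclic (λ acyclic → acyclic⇒acyclicOn acyclic ⊤))
    (trans (∏-cong vertex) (∏-if (sink? G o) t id)))
    where
    vertex : ∀ v → vertexSum (topWeight t) ⊤ v ≡ (if does (sink? G o v) then t else 1ℚ)
    vertex v = trans (vertexSum-in (topWeight t) ⊤ v Subset.∈⊤) (cases (sink? G o v))
      where
      cases : (s : Dec (Sink G o v)) →
        1ℚ + ((t - 1ℚ) * 𝟙 (uniform? ⊤ v toward) + 0ℚ * 𝟙 (uniform? ⊤ v away)) ≡ (if does s then t else 1ℚ)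
      cases (yes sink) = trans
        (cong (λ x → 1ℚ + ((t - 1ℚ) * x + 0ℚ * 𝟙 (uniform? ⊤ v away)))
          (𝟙-yes (uniform? ⊤ v toward) λ ε h _ → sink ε h))
        (solve 2 (λ t x → con 1ℚ :+ ((t :- con 1ℚ) :* con 1ℚ :+ con 0ℚ :* x) := t) refl t (𝟙 (uniform? ⊤ v away)))
      cases (no ¬sink) = trans
        (cong (λ x → 1ℚ + ((t - 1ℚ) * x + 0ℚ * 𝟙 (uniform? ⊤ v away)))
          (𝟙-no (uniform? ⊤ v toward) λ uniform → ¬sink λ ε h → uniform ε h λ _ → Subset.∈⊤))
        (solve 2 (λ t x → con 1ℚ :+ ((t :- con 1ℚ) :* con 0ℚ :+ con 0ℚ :* x) := con 1ℚ) refl t (𝟙 (uniform? ⊤ v away)))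

  sinkPolynomial-suc : IsOrientation G o → ∀ t m → let open Specialisation t m using (ξ) in
    sinkPolynomial t (suc m) ≡
    ∑ (colorTuples order (suc m)) (λ κ → ∏ (λ v → ξ (lookup κ v)) * 𝟙 (strict? ⊤ (lookup κ)))
  sinkPolynomial-suc oriented t m = begin
    sinkPolynomial t (suc m)
      ≡⟨ peel-cong (topWeight t) (strictSum≡extrapolated oriented m) ⊤ ⟨
    peel (topWeight t) (strictSum (λ _ → - 1ℚ) m) ⊤
      ≡⟨ strictSum-suc oriented ξ (topWeight t) m
           (λ { toward → ξ-top ; away → ξ-bottom }) (λ x → ξ-middle {x}) ⊤ ⟨
    strictSum ξ (suc m) ⊤
      ≡⟨ ∑-cong (colorTuples order (suc m)) (λ κ → cong (_* 𝟙 (strict? ⊤ (lookup κ)))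
           (∏-cong λ v → factor-in ξ {v = v} (lookup κ v) Subset.∈⊤)) ⟩
    ∑ (colorTuples order (suc m)) (λ κ → ∏ (λ v → ξ (lookup κ v)) * 𝟙 (strict? ⊤ (lookup κ))) ∎
    where open Specialisation t m using (ξ; ξ-top; ξ-bottom; ξ-middle)

-- Proper colorings and orientations

tuples-unique : ∀ n {as : List A} → Unique as → Unique (tuples n as)
tuples-unique zero    u = [] ∷ []
tuples-unique (suc n) u = Unique.cartesianProductWith⁺ _∷_ Vec.∷-injective u (tuples-unique n u)

∈-tuples : ∀ {n} {as : List A} (v : Vec A n) → (∀ i → lookup v i ∈ as) → v ∈ tuples n as
∈-tuples []      v∈ = here refl
∈-tuples (a ∷ v) v∈ = ∈.∈-cartesianProductWith⁺ _∷_ (v∈ zero) (∈-tuples v (v∈ ∘ suc))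

arrows : List Arrow
arrows = toward ∷ away ∷ []

∈-arrows : ∀ d → d ∈ arrows
∈-arrows toward = here refl
∈-arrows away   = there (here refl)

arrowPairs : List (Vec Arrow 2)
arrowPairs = tuples 2 arrows

arrowPairs-unique : Unique arrowPairs
arrowPairs-unique = tuples-unique 2 (((λ ()) ∷ []) ∷ [] ∷ [])

∈-arrowPairs : ∀ a → a ∈ arrowPairs
∈-arrowPairs a = ∈-tuples a λ i → ∈-arrows (lookup a i)

compatible? : ∀ s d d′ → Dec (Compatible s d d′)
compatible? Sign.+ d d′ = ¬? (d ≟ᵃ d′)
compatible? Sign.- d d′ = d ≟ᵃ d′

partner : Sign → Arrow → Arrow
partner Sign.+ = opposite-arrow
partner Sign.- = id

compatible-partner : ∀ s d → Compatible s d (partner s d)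
compatible-partner Sign.+ toward = λ ()
compatible-partner Sign.+ away   = λ ()
compatible-partner Sign.- d      = refl

compatible⇒partner : ∀ s d d′ → Compatible s d d′ → d′ ≡ partner s d
compatible⇒partner Sign.+ d d′ d≢d′ = [ (λ d′≡d → contradiction (sym d′≡d) d≢d′) , id ]′ (same-or-opposite d d′)
compatible⇒partner Sign.- d d′ d≡d′ = sym d≡d′

-- Viewing the inequality from the other end reverses it, and a negative sign reverses it once more;
-- so the arrow changes on positive edges only.
above-partner : ∀ s d x y → Above d x ((s ℤ.◃ 1) ℤ.* y) → Above (partner s d) y ((s ℤ.◃ 1) ℤ.* x)
above-partner Sign.+ d x y above with d
... | toward = subst₂ ℤ._<_ (ℤ.*-identityˡ y) (sym (ℤ.*-identityˡ x)) above
... | away   = subst₂ ℤ._<_ (sym (ℤ.*-identityˡ x)) (ℤ.*-identityˡ y) above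
above-partner Sign.- d x y above with d
... | toward = subst₂ ℤ._<_ (sym (ℤ.-1*i≡-i x)) (ℤ.neg-involutive y)
                 (ℤ.neg-mono-< (subst (ℤ._< x) (ℤ.-1*i≡-i y) above))
... | away   = subst₂ ℤ._<_ (ℤ.neg-involutive y) (sym (ℤ.-1*i≡-i x))
                 (ℤ.neg-mono-< (subst (x ℤ.<_) (ℤ.-1*i≡-i y) above))

above-unique : ∀ d d′ x y → Above d x y → Above d′ x y → d ≡ d′
above-unique toward toward x y _  _   = refl
above-unique toward away   x y y<x x<y = contradiction x<y (ℤ.<-asym y<x)
above-unique away   toward x y x<y y<x = contradiction x<y (ℤ.<-asym y<x)
above-unique away   away   x y _  _   = refl

≢⇒above : ∀ x y → x ≢ y → ∃[ d ] Above d x y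
≢⇒above x y x≢y with ℤ.<-cmp x y
... | tri< x<y _ _ = away , x<y
... | tri≈ _ x≡y _ = contradiction x≡y x≢y
... | tri> _ _ y<x = toward , y<x

-- The two families form one list over `A ⊎ B`, the second with the opposite sign, to which
-- `coefficients-vanish` applies.
coefficients-equal : ∀ (xs : List A) (ys : List B) (c : A → ℚ) (c′ : B → ℚ) (d : A → ℕ) (d′ : B → ℕ) →
  (∀ j → ∑ xs (λ x → c x * fromℕ j ^ d x) ≡ ∑ ys (λ y → c′ y * fromℕ j ^ d′ y)) →
  ∀ k → ∑ xs (λ x → c x * 𝟙 (d x ℕ.≟ k)) ≡ ∑ ys (λ y → c′ y * 𝟙 (d′ y ℕ.≟ k))
coefficients-equal {A = A} {B = B} xs ys c c′ d d′ eq k = begin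
  X₁                        ≡⟨ solve 2 (λ a b → a := (a :+ con (- 1ℚ) :* b) :+ b) refl X₁ Y₁ ⟩
  X₁ + - 1ℚ * Y₁ + Y₁       ≡⟨ cong (_+ Y₁) (trans (sym (combine λ n → 𝟙 (n ℕ.≟ k)))
                                 (coefficients-vanish zs c″ d″ vanish k)) ⟩
  0ℚ + Y₁                   ≡⟨ ℚ.+-identityˡ Y₁ ⟩
  Y₁                        ∎
  where
  X₁ = ∑ xs (λ x → c x * 𝟙 (d x ℕ.≟ k))
  Y₁ = ∑ ys (λ y → c′ y * 𝟙 (d′ y ℕ.≟ k))
  zs : List (A ⊎ B)
  zs = List.map inj₁ xs ++ List.map inj₂ ys
  c″ : A ⊎ B → ℚ
  c″ = [ c , (λ y → - 1ℚ * c′ y) ]′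
  d″ : A ⊎ B → ℕ
  d″ = [ d , d′ ]′
  combine : ∀ (u : ℕ → ℚ) → ∑ zs (λ z → c″ z * u (d″ z))
            ≡ ∑ xs (λ x → c x * u (d x)) + - 1ℚ * ∑ ys (λ y → c′ y * u (d′ y))
  combine u = trans (∑-++ (List.map inj₁ xs) (List.map inj₂ ys) _) (cong₂ _+_
    (∑-map inj₁ xs _)
    (trans (∑-map inj₂ ys _) (trans (∑-cong ys λ y → ℚ.*-assoc (- 1ℚ) (c′ y) (u (d′ y))) (∑-*ˡ ys (- 1ℚ) _))))
  vanish : ∀ j → ∑ zs (λ z → c″ z * fromℕ j ^ d″ z) ≡ 0ℚ
  vanish j = trans (combine (fromℕ j ^_)) (trans
    (cong (λ x → x + - 1ℚ * ∑ ys (λ y → c′ y * fromℕ j ^ d′ y)) (eq j))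
    (solve 1 (λ x → x :+ con (- 1ℚ) :* x := con 0ℚ) refl (∑ ys (λ y → c′ y * fromℕ j ^ d′ y))))

module _ (G : SignedGraph) where
  open SignedGraph G
  open Reciprocity G

  allArrows : List (Arrows G)
  allArrows = tuples size arrowPairs

  isOrientation? : ∀ o → Dec (IsOrientation G o)
  isOrientation? o = Fin.all? λ ε → compatible? (sgn ε) (arrow G o ε zero) (arrow G o ε (suc zero))

  module _ (κ : Vertex → ℤ) where

    StrictEdge : Edge → Vec Arrow 2 → Set
    StrictEdge ε a = Compatible (sgn ε) (lookup a zero) (lookup a (suc zero)) ×
      (∀ h → Above (lookup a h) (κ (endpoint ε h)) ((sgn ε ℤ.◃ 1) ℤ.* κ (endpoint ε (Fin.opposite h))))

    strictEdge? : ∀ ε a → Dec (StrictEdge ε a)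
    strictEdge? ε a = compatible? (sgn ε) (lookup a zero) (lookup a (suc zero)) ×-dec
      Fin.all? λ h → above? (lookup a h) _ _

    ProperEdge : Edge → Set
    ProperEdge ε = κ (endpoint ε zero) ≢ (sgn ε ℤ.◃ 1) ℤ.* κ (endpoint ε (suc zero))

    -- On a proper edge the comparison of the colors determines the first arrow and compatibility
    -- the second. On an improper edge both arrows fail, by irreflexivity.
    ∑-strictEdge : ∀ ε → (proper? : Dec (ProperEdge ε)) → ∑ arrowPairs (λ a → 𝟙 (strictEdge? ε a)) ≡ 𝟙 proper?
    ∑-strictEdge ε (no ¬proper) = trans
      (∑-cong arrowPairs λ a → 𝟙-no (strictEdge? ε a) λ (_ , above) →
        ¬proper λ x≡y → above-irrefl (lookup a zero) _ (subst (Above (lookup a zero) _) (sym x≡y) (above zero)))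
      (∑-zero arrowPairs)
    ∑-strictEdge ε (yes proper) = trans
      (unique⇒once arrowPairs-unique (∈-arrowPairs a) _ λ a′ a′≢a → 𝟙-no (strictEdge? ε a′) (a′≢a ∘ unique a′))
      (𝟙-yes (strictEdge? ε a) strict)
      where
      s = sgn ε
      x = κ (endpoint ε zero)
      y = κ (endpoint ε (suc zero))
      d = proj₁ (≢⇒above x ((s ℤ.◃ 1) ℤ.* y) proper)
      above : Above d x ((s ℤ.◃ 1) ℤ.* y)
      above = proj₂ (≢⇒above x ((s ℤ.◃ 1) ℤ.* y) proper)
      a : Vec Arrow 2
      a = d ∷ partner s d ∷ []
      strict : StrictEdge ε a
      strict = compatible-partner s d , λ { zero → above ; (suc zero) → above-partner s d x y above }
      unique : ∀ a′ → StrictEdge ε a′ → a′ ≡ a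
      unique (d₀ ∷ d₁ ∷ []) (compatible , above′)
        with refl ← above-unique d₀ d x ((s ℤ.◃ 1) ℤ.* y) (above′ zero) above
        with refl ← compatible⇒partner s d₀ d₁ compatible = refl

  -- A proper coloring is strict for exactly one orientation.
  𝟙-proper : ∀ κ → 𝟙 (proper? G κ) ≡
    ∑ allArrows (λ o → 𝟙 (isOrientation? o) * 𝟙 (Peeling.strict? G o ⊤ (lookup κ)))
  𝟙-proper κ = begin
    𝟙 (proper? G κ)
      ≡⟨ 𝟙-all properEdge? (proper? G κ) ⟩
    ∏ (λ ε → 𝟙 (properEdge? ε))
      ≡⟨ ∏-cong (λ ε → ∑-strictEdge (lookup κ) ε (properEdge? ε)) ⟨
    ∏ (λ ε → ∑ arrowPairs (λ a → 𝟙 (strictEdge? (lookup κ) ε a)))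
      ≡⟨ ∑-tuples-∏ arrowPairs (λ ε a → 𝟙 (strictEdge? (lookup κ) ε a)) ⟨
    ∑ allArrows (λ o → ∏ (λ ε → 𝟙 (strictEdge? (lookup κ) ε (lookup o ε))))
      ≡⟨ ∑-cong allArrows (λ o → begin
           ∏ (λ ε → 𝟙 (strictEdge? (lookup κ) ε (lookup o ε)))
             ≡⟨ 𝟙-all (λ ε → strictEdge? (lookup κ) ε (lookup o ε)) (allStrict? o) ⟨
           𝟙 (allStrict? o)
             ≡⟨ 𝟙-⇔ (allStrict? o) (isOrientation? o ×-dec Peeling.strict? G o ⊤ (lookup κ))
                  (λ all → (λ ε → proj₁ (all ε)) , (λ ε _ → proj₂ (all ε)))
                  (λ (oriented , strict) ε → oriented ε , strict ε λ _ → Subset.∈⊤) ⟩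
           𝟙 (isOrientation? o ×-dec Peeling.strict? G o ⊤ (lookup κ))
             ≡⟨ 𝟙-× (isOrientation? o) (Peeling.strict? G o ⊤ (lookup κ)) ⟩
           𝟙 (isOrientation? o) * 𝟙 (Peeling.strict? G o ⊤ (lookup κ)) ∎) ⟩
    ∑ allArrows (λ o → 𝟙 (isOrientation? o) * 𝟙 (Peeling.strict? G o ⊤ (lookup κ))) ∎
    where
    properEdge? : ∀ ε → Dec (ProperEdge (lookup κ) ε)
    properEdge? ε = ¬? (_ ℤ.≟ _)
    allStrict? : ∀ o → Dec (∀ ε → StrictEdge (lookup κ) ε (lookup o ε))
    allStrict? o = Fin.all? λ ε → strictEdge? (lookup κ) ε (lookup o ε)

  properSum : ∀ t m → let open Specialisation t m using (ξ) in
    ∑ (colorTuples order (suc m)) (λ κ → 𝟙 (proper? G κ) * ∏ (λ v → ξ (lookup κ v)))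
    ≡ ∑ allArrows (λ o → 𝟙 (isOrientation? o) * sinkPolynomial o t (suc m))
  properSum t m = begin
    ∑ κs (λ κ → 𝟙 (proper? G κ) * Ξ κ)
      ≡⟨ ∑-cong κs (λ κ → trans (cong (_* Ξ κ) (𝟙-proper κ)) (trans
           (sym (∑-*ʳ allArrows (Ξ κ) _))
           (∑-cong allArrows λ o → solve 3 (λ a b c → a :* b :* c := a :* (c :* b)) refl
             (𝟙 (isOrientation? o)) (𝟙 (Peeling.strict? G o ⊤ (lookup κ))) (Ξ κ)))) ⟩
    ∑ κs (λ κ → ∑ allArrows (λ o → 𝟙 (isOrientation? o) * (Ξ κ * 𝟙 (Peeling.strict? G o ⊤ (lookup κ)))))
      ≡⟨ ∑-swap κs allArrows _ ⟩
    ∑ allArrows (λ o → ∑ κs (λ κ → 𝟙 (isOrientation? o) * (Ξ κ * 𝟙 (Peeling.strict? G o ⊤ (lookup κ)))))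
      ≡⟨ ∑-cong allArrows (λ o → trans (∑-*ˡ κs (𝟙 (isOrientation? o)) _)
           (𝟙-cong-* (isOrientation? o) λ oriented → sym (sinkPolynomial-suc o oriented t m))) ⟩
    ∑ allArrows (λ o → 𝟙 (isOrientation? o) * sinkPolynomial o t (suc m)) ∎
    where
    open Specialisation t m using (ξ)
    κs = colorTuples order (suc m)
    Ξ : Coloring G → ℚ
    Ξ κ = ∏ (λ v → ξ (lookup κ v))

  -- Counting acyclic orientations by their sinks

  acyclicOrientation? : ∀ o → Dec (IsOrientation G o × Acyclic G o)
  acyclicOrientation? o = isOrientation? o ×-dec Acyclicity.acyclic? G o

  -- Both sides are values at `j = 0` of polynomials in `j`. At `j = m + 1` these agree, since both
  -- are the value of `X G` under the substitution `ξ` for `m`.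
  generatingFunction : ∀ P → ⟦ P ⟧ ≈ X G → ∀ t →
    ∑ P (λ r → proj₁ r * t ^ eDegree (proj₂ r)) ≡ ∑ allArrows (λ o → 𝟙 (acyclicOrientation? o) * t ^ sinks G o)
  generatingFunction P P≈X t = begin
    ∑ P (λ r → proj₁ r * t ^ eDegree (proj₂ r))
      ≡⟨ ∑-cong P (λ r → cong (proj₁ r *_) (monomialValue-0 t (proj₂ r))) ⟨
    ∑ P (λ r → proj₁ r * monomialValue (generatorValue t 0) (proj₂ r))
      ≡⟨ extrapolate
           (polynomial-∑ P λ r → polynomial-* (polynomial-const (proj₁ r)) (polynomial-monomialValue t (proj₂ r)))
           (polynomial-∑ allArrows λ o →
             polynomial-* (polynomial-const (𝟙 (isOrientation? o))) (polynomial-sinkPolynomial o t))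
           (λ m → let open Specialisation t m in
             trans (value-unique (P≈X (suc m)) (polynomial-value P) (X-value G)) (properSum t m)) ⟩
    ∑ allArrows (λ o → 𝟙 (isOrientation? o) * sinkPolynomial o t 0)
      ≡⟨ ∑-cong allArrows (λ o → trans (cong (𝟙 (isOrientation? o) *_) (sinkPolynomial-0 o t)) (trans
           (sym (ℚ.*-assoc (𝟙 (isOrientation? o)) (𝟙 (Acyclicity.acyclic? G o)) _))
           (cong (_* t ^ sinks G o) (sym (𝟙-× (isOrientation? o) (Acyclicity.acyclic? G o)))))) ⟩
    ∑ allArrows (λ o → 𝟙 (acyclicOrientation? o) * t ^ sinks G o) ∎

  acyclicOrientationWithSinks? : ∀ k o → Dec (AcyclicOrientationWithSinks G k o)
  acyclicOrientationWithSinks? k o = isOrientation? o ×-dec (Acyclicity.acyclic? G o ×-dec sinks G o ℕ.≟ k)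

  acyclicOrientations : ℕ → List (Arrows G)
  acyclicOrientations k = filter (acyclicOrientationWithSinks? k) allArrows

  ∈-allArrows : ∀ o → o ∈ allArrows
  ∈-allArrows o = ∈-tuples {as = arrowPairs} o λ ε → ∈-arrowPairs (lookup o ε)

  ∈-acyclicOrientations⁺ : ∀ k o → AcyclicOrientationWithSinks G k o → o ∈ acyclicOrientations k
  ∈-acyclicOrientations⁺ k o acyclic = ∈.∈-filter⁺ (acyclicOrientationWithSinks? k) (∈-allArrows o) acyclic

  ∈-acyclicOrientations⁻ : ∀ k o → o ∈ acyclicOrientations k → AcyclicOrientationWithSinks G k o
  ∈-acyclicOrientations⁻ k o o∈ = proj₂ (∈.∈-filter⁻ (acyclicOrientationWithSinks? k) {xs = allArrows} o∈)

  ∈-acyclicOrientations⇔ : ∀ k o → o ∈ acyclicOrientations k ⇔ AcyclicOrientationWithSinks G k o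
  ∈-acyclicOrientations⇔ k o = mk⇔ (∈-acyclicOrientations⁻ k o) (∈-acyclicOrientations⁺ k o)

  acyclicOrientations-unique : ∀ k → Unique (acyclicOrientations k)
  acyclicOrientations-unique k =
    Unique.filter⁺ (acyclicOrientationWithSinks? k) (tuples-unique size arrowPairs-unique)

  hasCount-acyclicOrientations : ∀ k → HasCount (AcyclicOrientationWithSinks G k) (length (acyclicOrientations k))
  hasCount-acyclicOrientations k =
    acyclicOrientations k , acyclicOrientations-unique k , ∈-acyclicOrientations⇔ k , refl

  fromℕ-length-acyclicOrientations : ∀ k → fromℕ (length (acyclicOrientations k)) ≡
    ∑ allArrows (λ o → 𝟙 (acyclicOrientation? o) * 𝟙 (sinks G o ℕ.≟ k))
  fromℕ-length-acyclicOrientations k = begin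
    fromℕ (length (acyclicOrientations k))
      ≡⟨ fromℕ-length (acyclicOrientations k) ⟩
    ∑ (acyclicOrientations k) (λ _ → 1ℚ)
      ≡⟨ ∑-filter (acyclicOrientationWithSinks? k) allArrows (λ _ → 1ℚ) ⟩
    ∑ allArrows (λ o → 𝟙 (acyclicOrientationWithSinks? k o) * 1ℚ)
      ≡⟨ ∑-cong allArrows (λ o → trans (ℚ.*-identityʳ (𝟙 (acyclicOrientationWithSinks? k o))) (trans
           (𝟙-⇔ (acyclicOrientationWithSinks? k o) (acyclicOrientation? o ×-dec sinks G o ℕ.≟ k)
             (λ (a , b , c) → (a , b) , c) (λ ((a , b) , c) → a , b , c))
           (𝟙-× (acyclicOrientation? o) (sinks G o ℕ.≟ k)))) ⟩
    ∑ allArrows (λ o → 𝟙 (acyclicOrientation? o) * 𝟙 (sinks G o ℕ.≟ k)) ∎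

coefficientSum-𝟙 : ∀ k P → coefficientSum k P ≡ ∑ P (λ r → proj₁ r * 𝟙 (eDegree (proj₂ r) ℕ.≟ k))
coefficientSum-𝟙 k P = trans (∑-filter (λ r → eDegree (proj₂ r) ℕ.≟ k) P proj₁)
  (∑-cong P λ r → ℚ.*-comm (𝟙 (eDegree (proj₂ r) ℕ.≟ k)) (proj₁ r))

sinks≡eDegree : ∀ G P → ⟦ P ⟧ ≈ X G → ∀ k →
  ∑ P (λ r → proj₁ r * 𝟙 (eDegree (proj₂ r) ℕ.≟ k)) ≡
  ∑ (allArrows G) (λ o → 𝟙 (acyclicOrientation? G o) * 𝟙 (sinks G o ℕ.≟ k))
sinks≡eDegree G P P≈X = coefficients-equal P (allArrows G) proj₁ (λ o → 𝟙 (acyclicOrientation? G o))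
  (λ r → eDegree (proj₂ r)) (λ o → sinks G o) (λ j → generatingFunction G P P≈X (fromℕ j))

number≡coefficientSum : ∀ G P → ⟦ P ⟧ ≈ X G → ∀ k → fromℕ (length (acyclicOrientations G k)) ≡ coefficientSum k P
number≡coefficientSum G P P≈X k = trans (fromℕ-length-acyclicOrientations G k)
  (trans (sym (sinks≡eDegree G P P≈X k)) (sym (coefficientSum-𝟙 k P)))

theorem3p1 : (G : SignedGraph) (P : Polynomial) → ⟦ P ⟧ ≈ X G →
    (k : ℕ) → Σ[ c ∈ ℕ ] HasCount (AcyclicOrientationWithSinks G k) c × fromℕ c ≡ coefficientSum k P
theorem3p1 G P P≈X k =
  length (acyclicOrientations G k) , hasCount-acyclicOrientations G k , number≡coefficientSum G P P≈X k
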